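{- Let $p$ be a prime, let $q=p^h$ with $h\geq 1$, and let $k$ be a positive integer. Let $S$ be a set of vectors of ${\mathbb F}_q^k$ with the property that every subset of $S$ of size $k$ is a basis of ${\mathbb F}_q^k$. If $k \leq p$ then $|S| \leq q+1$.
   Context: ${\mathbb F}_q$ denotes the finite field with $q$ elements. -}

module Defs where

open import Algebra.Bundles using (CommutativeRing)
open import Algebra.Definitions using (Invertible)
import Algebra.Properties.Semiring.Sum as Sum
open import Data.Fin.Base using (Fin)
open import Data.Nat.Base using (ℕ)
open import Data.Product.Base using (_×_; ∃-syntax)
open import Data.Vec.Functional using (Vector)
import Data.List.Relation.Binary.Subset.Setoid as Subset
import Data.List.Relation.Unary.Unique.Setoid as Unique
import Data.Vec.Functional.Relation.Binary.Equality.Setoid as VectorEquality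
open import Function.Bundles using (Inverse)
open import Level using (Level; _⊔_; suc)
open import Relation.Binary.Bundles using (Setoid)
open import Relation.Binary.PropositionalEquality using (setoid)

record Field (c ℓ : Level) : Set (suc (c ⊔ ℓ)) where
  field
    commutativeRing : CommutativeRing c ℓ

  open CommutativeRing commutativeRing public

  field
    0≉1           : 0# ≉ 1#
    ≉0⇒invertible : ∀ x → x ≉ 0# → Invertible _≈_ 1# _*_ x

HasSize : ∀ {c ℓ} → Setoid c ℓ → ℕ → Set (c ⊔ ℓ)
HasSize A n = Inverse A (setoid (Fin n))

-- The coordinate space Fᵏ, with vectors compared coordinatewise up to the
-- equality of F.
module CoordinateSpace {c ℓ : Level} (F : Field c ℓ) (k : ℕ) where

  private module F = Field F
  open F using (Carrier; _≈_; _*_; 0#)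
  open Sum F.semiring using (sum)
  open VectorEquality F.setoid using (_≋_; ≋-setoid)

  V : Set c
  V = Vector Carrier k

  V-setoid : Setoid c ℓ
  V-setoid = ≋-setoid k

  0ᵥ : V
  0ᵥ _ = 0#

  linearCombination : ∀ {n} → Vector Carrier n → Vector V n → V
  linearCombination a v j = sum (λ i → a i * v i j)

  LinearlyIndependent : ∀ {n} → Vector V n → Set (c ⊔ ℓ)
  LinearlyIndependent v =
    ∀ a → linearCombination a v ≋ 0ᵥ → ∀ i → a i ≈ 0#

  Spanning : ∀ {n} → Vector V n → Set (c ⊔ ℓ)
  Spanning v = ∀ w → ∃[ a ] linearCombination a v ≋ w

  IsBasis : ∀ {n} → Vector V n → Set (c ⊔ ℓ)
  IsBasis v = LinearlyIndependent v × Spanning v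

  -- A finite set of vectors is a list without repetitions (up to the equality
  -- of V); its cardinality is then the length of the list.
  open Subset V-setoid public using (_⊆_)
  open Unique V-setoid public using (Unique)

{-# OPTIONS --safe #-}

-- Ball's proof.  Suppose the arc has q + 2 vectors, let r = k - 1 and write
-- E = C₀ ∪ C₁ ⊆ S with |C₀| = r and |C₁| = r - 1.  For an r-subset C of E let
--   β(C) = ∏_{z ∈ E \ C} det(z , C)⁻² ∏_{s ∈ S \ E} det(s , C)⁻¹.
-- Fix r - 1 vectors Y of E.  Modulo Y the arc becomes a set of distinct points
-- on a projective line, and Lagrange interpolation of the polynomial vanishing
-- at the points of the line outside the arc gives Σ_{a ∈ E \ Y} β(a , Y) = 0.
-- Hence, by inclusion and exclusion, r! β(C₀) is up to sign r! times the sum of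
-- β over the r-subsets of C₁.  There are none, so r! β(C₀) = 0; but r < p and β
-- has no zeros.  This requires |E| = 2r - 1 ≤ q + 2.  Otherwise k > (q + 5) / 2,
-- and the argument is applied to the dual arc, which lives in dimension q + 2 - k.
module Submission where

open import Defs
open import Algebra.Bundles using (CommutativeMonoid)
open import Data.Bool.Base using (Bool; true; false)
open import Data.Empty using (⊥; ⊥-elim)
open import Data.Fin.Base using (Fin; zero; suc; inject≤)
import Data.Fin.Properties as Fin
open import Data.List.Base
  using (List; []; _∷_; _++_; length; lookup; map; replicate; allFin; take; drop)
import Data.List.Membership.DecPropositional as Membership
open import Data.List.Membership.Propositional using (_∈_)
open import Data.List.Membership.Propositional.Properties
  using (∈-++⁺ˡ; ∈-++⁺ʳ; ∈-++⁻; ∈-allFin; ∈-map⁺; ∈-lookup)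
open import Data.List.Properties
  using ( ++-assoc; ++-identityʳ; length-++; length-map; length-tabulate; length-replicate
        ; length-take; length-drop; take++drop≡id)
open import Data.List.Relation.Binary.Permutation.Propositional
  using (_↭_; ↭-refl; ↭-sym; ↭-trans; ↭-reflexive; ↭⇒↭ₛ; prep; swap)
open import Data.List.Relation.Binary.Permutation.Propositional.Properties
  using (∈-resp-↭; ↭-length; shift; map⁺; ++⁺ʳ; ++-comm)
import Data.List.Relation.Binary.Permutation.Setoid.Properties as ↭ₛ
open import Data.List.Relation.Unary.All as All using (All; []; _∷_)
import Data.List.Relation.Unary.All.Properties as All
open import Data.List.Relation.Unary.AllPairs as AllPairs using (AllPairs; []; _∷_)
import Data.List.Relation.Unary.AllPairs.Properties as AllPairs
open import Data.List.Relation.Unary.Any as Any using (here; there)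
open import Data.List.Relation.Unary.Unique.DecPropositional using (unique?)
open import Data.List.Relation.Unary.Unique.Propositional using () renaming (Unique to Uniqueₚ)
import Data.List.Relation.Unary.Unique.Propositional.Properties as Unique
open import Data.Nat.Base as ℕ using (ℕ; zero; suc; _≤_; _<_; s≤s)
open import Data.Nat.Coprimality using (prime⇒coprime; coprime-Bézout)
open import Data.Nat.GCD using (module Bézout)
open import Data.Nat.Primality using (Prime; prime⇒nonTrivial; prime⇒nonZero)
import Data.Nat.Properties as ℕ
open import Data.Product.Base using (_×_; _,_; ∃; ∃₂; proj₁; proj₂)
open import Data.Sum.Base using (_⊎_; inj₁; inj₂)
open import Data.Vec.Base as Vec using (Vec; []; _∷_)
open import Function.Base using (_∘_; id)
open import Function.Bundles using (Inverse)
open import Level using (Level; _⊔_)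
open import Relation.Binary.Core using (Rel)
open import Relation.Binary.Definitions using (DecidableEquality)
open import Relation.Binary.PropositionalEquality as ≡ using (_≡_; _≢_)
open import Relation.Nullary using (¬_; Dec; yes; no; contradiction)
open import Relation.Nullary.Decidable using (map′)

-- The exponents -2 and -1 come from homogeneity. Let O be S without E, so |O| = q + 3 - 2r. In the
-- sum of β(a , Y) over a, the term of a contains the vector a with total exponent -(2(r - 1) + |O|)
-- = -(q + 1), which is -2 modulo q - 1, and every other term contains a with exponent -2 as well.
-- Rescaling a vector therefore multiplies all terms by the same factor, and the identity concerns
-- points of a line. The same count leaves r - 2 points of that line off the arc. With one point of
-- E sent to infinity, r - 1 nodes remain for a polynomial of degree r - 2, so the interpolation sum
-- is its leading coefficient, and this cancels the term at infinity. Determinants depend on the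
-- order of C, yet β must not: the squares hide the sign over E, and over O it disappears because
-- |O| has the parity of q - 1.

module _ {a} {A : Set a} where

  -- Lists without repetitions.

  Unique-resp-↭ : ∀ {xs ys : List A} → xs ↭ ys → Uniqueₚ xs → Uniqueₚ ys
  Unique-resp-↭ p = ↭ₛ.Unique-resp-↭ (≡.setoid A) (↭⇒↭ₛ p)

  ∈⇒↭∷ : ∀ {x : A} {xs} → x ∈ xs → ∃ λ ys → xs ↭ x ∷ ys
  ∈⇒↭∷ {xs = _ ∷ xs} (here ≡.refl) = xs , ↭-refl
  ∈⇒↭∷ {xs = y ∷ _} (there x∈xs) with ys , p ← ∈⇒↭∷ x∈xs =
    y ∷ ys , ↭-trans (prep y p) (swap y _ ↭-refl)

  -- Complements are formed this way throughout: `zs` is what remains of `ys` once `xs` is removed.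
  unique-⊆⇒↭++ : ∀ {xs ys : List A} → Uniqueₚ xs → (∀ {x} → x ∈ xs → x ∈ ys) →
                 ∃ λ zs → ys ↭ xs ++ zs
  unique-⊆⇒↭++ {[]} {ys} _ _ = ys , ↭-refl
  unique-⊆⇒↭++ {x ∷ xs} u@(_ ∷ u′) xs⊆ys with ys′ , p ← ∈⇒↭∷ (xs⊆ys (here ≡.refl)) =
    let zs , r = unique-⊆⇒↭++ u′ xs⊆ys′ in zs , ↭-trans p (prep x r)
    where
    xs⊆ys′ : ∀ {z} → z ∈ xs → z ∈ ys′
    xs⊆ys′ z∈xs with ∈-resp-↭ p (xs⊆ys (there z∈xs))
    ... | here ≡.refl = contradiction z∈xs (Unique.Unique[x∷xs]⇒x∉xs u)
    ... | there z∈ys′ = z∈ys′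

  unique-⊆⇒length≤ : ∀ {xs ys : List A} → Uniqueₚ xs → (∀ {x} → x ∈ xs → x ∈ ys) →
                     length xs ≤ length ys
  unique-⊆⇒length≤ {xs} u s with zs , p ← unique-⊆⇒↭++ u s
    rewrite ↭-length p | length-++ xs {zs} = ℕ.m≤m+n _ _

  unique-⊆-length⇒↭ : ∀ {xs ys : List A} → Uniqueₚ xs → (∀ {x} → x ∈ xs → x ∈ ys) →
                      length xs ≡ length ys → ys ↭ xs
  unique-⊆-length⇒↭ {xs} u s eq with unique-⊆⇒↭++ u s
  ... | [] , p = ↭-trans p (↭-reflexive (++-identityʳ xs))
  ... | z ∷ zs , p = contradiction (≡.trans eq (≡.trans (↭-length p) (length-++ xs)))
                       (ℕ.m≢1+m+n (length xs) ∘ (λ e → ≡.trans e (ℕ.+-suc (length xs) (length zs))))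

  unique-++⁻ : ∀ (xs : List A) {ys} → Uniqueₚ (xs ++ ys) → Uniqueₚ xs × Uniqueₚ ys
  unique-++⁻ [] u = [] , u
  unique-++⁻ (x ∷ xs) (d ∷ u) with v , w ← unique-++⁻ xs u = All.++⁻ˡ xs d ∷ v , w

  unique-++-disjoint : ∀ {xs ys : List A} {x y} → Uniqueₚ (xs ++ ys) → x ∈ xs → y ∈ ys → x ≢ y
  unique-++-disjoint {_ ∷ xs} (d ∷ _) (here ≡.refl) y∈ys = All.lookup d (∈-++⁺ʳ xs y∈ys)
  unique-++-disjoint (_ ∷ u) (there x∈xs) y∈ys = unique-++-disjoint u x∈xs y∈ys

  -- Brings two equal entries to the front, where the alternating law `∧-self` can act on them.
  ¬unique⇒↭∷∷ : DecidableEquality A → ∀ (xs : List A) → ¬ Uniqueₚ xs →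
                ∃₂ λ x ys → xs ↭ x ∷ x ∷ ys
  ¬unique⇒↭∷∷ _≟_ [] ¬u = contradiction [] ¬u
  ¬unique⇒↭∷∷ _≟_ (x ∷ xs) ¬u with Membership._∈?_ _≟_ x xs
  ... | yes x∈xs = let ys , p = ∈⇒↭∷ x∈xs in x , ys , prep x p
  ... | no  x∉xs =
    let y , ys , p = ¬unique⇒↭∷∷ _≟_ xs (λ u → ¬u (All.¬Any⇒All¬ xs x∉xs ∷ u))
    in y , x ∷ ys , ↭-trans (prep x p) (↭-trans (swap x y ↭-refl) (prep y (swap x y ↭-refl)))

-- Sums and products over lists, in a commutative monoid.

module ListFold {c ℓ} (M : CommutativeMonoid c ℓ) where
  open CommutativeMonoid M
  open import Relation.Binary.Reasoning.Setoid setoid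
  open import Algebra.Properties.CommutativeSemigroup commutativeSemigroup
    using (x∙yz≈y∙xz; interchange)

  private variable
    i j : Level
    I : Set i
    J : Set j

  fold : (I → Carrier) → List I → Carrier
  fold f []       = ε
  fold f (x ∷ xs) = f x ∙ fold f xs

  fold-cong : ∀ {f g : I → Carrier} xs → (∀ {x} → x ∈ xs → f x ≈ g x) → fold f xs ≈ fold g xs
  fold-cong []       f≈g = refl
  fold-cong (x ∷ xs) f≈g = ∙-cong (f≈g (here ≡.refl)) (fold-cong xs (f≈g ∘ there))

  fold-ε : ∀ {f : I → Carrier} xs → (∀ {x} → x ∈ xs → f x ≈ ε) → fold f xs ≈ ε
  fold-ε []       f≈ε = refl
  fold-ε (x ∷ xs) f≈ε =
    trans (∙-cong (f≈ε (here ≡.refl)) (fold-ε xs (f≈ε ∘ there))) (identityˡ ε)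

  fold-++ : ∀ (f : I → Carrier) xs ys → fold f (xs ++ ys) ≈ fold f xs ∙ fold f ys
  fold-++ f []       ys = sym (identityˡ _)
  fold-++ f (x ∷ xs) ys = begin
    f x ∙ fold f (xs ++ ys)       ≈⟨ ∙-congˡ (fold-++ f xs ys) ⟩
    f x ∙ (fold f xs ∙ fold f ys) ≈⟨ assoc _ _ _ ⟨
    f x ∙ fold f xs ∙ fold f ys   ∎

  fold-map : ∀ (f : J → Carrier) (g : I → J) xs → fold f (map g xs) ≈ fold (f ∘ g) xs
  fold-map f g []       = refl
  fold-map f g (x ∷ xs) = ∙-congˡ (fold-map f g xs)

  fold-↭ : ∀ (f : I → Carrier) {xs ys} → xs ↭ ys → fold f xs ≈ fold f ys
  fold-↭ f _↭_.refl     = refl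
  fold-↭ f (prep x p)   = ∙-congˡ (fold-↭ f p)
  fold-↭ f (swap x y p) =
    trans (x∙yz≈y∙xz _ _ _) (∙-congˡ (∙-congˡ (fold-↭ f p)))
  fold-↭ f (_↭_.trans p q) = trans (fold-↭ f p) (fold-↭ f q)

  fold-∙ : ∀ (f g : I → Carrier) xs → fold (λ x → f x ∙ g x) xs ≈ fold f xs ∙ fold g xs
  fold-∙ f g []       = sym (identityˡ ε)
  fold-∙ f g (x ∷ xs) = trans (∙-congˡ (fold-∙ f g xs)) (interchange _ _ _ _)

  fold-swap : ∀ (f : I → J → Carrier) xs ys →
              fold (λ x → fold (f x) ys) xs ≈ fold (λ y → fold (λ x → f x y) xs) ys
  fold-swap f []       ys = sym (fold-ε ys (λ _ → refl))
  fold-swap f (x ∷ xs) ys =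
    trans (∙-congˡ (fold-swap f xs ys)) (sym (fold-∙ (f x) _ ys))

  -- For products in which one factor is a default value that breaks the general formula; `e` is the
  -- correction.
  fold-update : ∀ {f g : I → Carrier} {e a} xs → Uniqueₚ xs → a ∈ xs →
                (∀ {x} → x ∈ xs → x ≢ a → f x ≈ g x) → f a ≈ e ∙ g a →
                fold f xs ≈ e ∙ fold g xs
  fold-update {f = f} {g} {e} (x ∷ xs) (d ∷ u) (here ≡.refl) f≈g fa = begin
    f x ∙ fold f xs       ≈⟨ ∙-cong fa (fold-cong xs λ y∈ → f≈g (there y∈) (All.lookup d y∈ ∘ ≡.sym)) ⟩
    e ∙ g x ∙ fold g xs   ≈⟨ assoc _ _ _ ⟩
    e ∙ (g x ∙ fold g xs) ∎
  fold-update {f = f} {g} {e} (x ∷ xs) (d ∷ u) (there a∈) f≈g fa = begin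
    f x ∙ fold f xs       ≈⟨ ∙-cong (f≈g (here ≡.refl) (All.lookup d a∈)) (fold-update xs u a∈ (f≈g ∘ there) fa) ⟩
    g x ∙ (e ∙ fold g xs) ≈⟨ x∙yz≈y∙xz _ _ _ ⟩
    e ∙ (g x ∙ fold g xs) ∎

-- Arithmetic of a finite field.

module FiniteField {c ℓ} (F : Field c ℓ) (q : ℕ) (size : HasSize (Field.setoid F) q) where

  open Field F public hiding (zero)
  open import Algebra.Properties.Ring ring public
    using (-‿distribˡ-*; -‿distribʳ-*; -‿+-comm; -0#≈0#; -‿involutive)
  open import Algebra.Properties.Group +-group public
    using (inverseʳ-unique; x∙y⁻¹≈ε⇒x≈y; x≈y⇒x∙y⁻¹≈ε; ∙-cancelˡ)
  open import Algebra.Properties.AbelianGroup +-abelianGroup public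
    using () renaming (⁻¹-anti-homo‿- to -[x-y]≈y-x)
  open import Algebra.Properties.Semiring.Exp semiring public
    using (_^_; ^-congˡ; ^-congʳ; ^-homo-*)
  open import Algebra.Properties.Semiring.Mult semiring public
    using (×-congˡ; ×-congʳ; ×1-homo-*; ×-assoc-*)
    renaming (_×_ to _·_)
  open import Relation.Binary.Reasoning.Setoid setoid
  open import Algebra.Properties.CommutativeSemigroup *-commutativeSemigroup
    using () renaming (x∙yz≈y∙xz to x*yz≈y*xz; interchange to *-interchange) public
  open import Algebra.Properties.CommutativeSemigroup +-commutativeSemigroup
    using () renaming (interchange to +-interchange) public

  open Inverse size using (to; from; to-cong; strictlyInverseˡ; strictlyInverseʳ) public

  to-injective : ∀ {x y} → to x ≡ to y → x ≈ y
  to-injective {x} {y} e = trans (sym (strictlyInverseʳ x)) (trans (reflexive (≡.cong from e)) (strictlyInverseʳ y))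

  from-injective : ∀ {i j} → from i ≈ from j → i ≡ j
  from-injective {i} {j} e = ≡.trans (≡.sym (strictlyInverseˡ i)) (≡.trans (to-cong e) (strictlyInverseˡ j))

  infix 4 _≈?_
  _≈?_ : ∀ x y → Dec (x ≈ y)
  x ≈? y = map′ to-injective to-cong (to x Fin.≟ to y)

  -- The inverse is totalised by 0⁻¹ = 1.
  infix 9 _⁻¹
  _⁻¹ : Carrier → Carrier
  x ⁻¹ with x ≈? 0#
  ... | yes _   = 1#
  ... | no  x≉0 = proj₁ (≉0⇒invertible x x≉0)

  0⁻¹ : ∀ {x} → x ≈ 0# → x ⁻¹ ≈ 1#
  0⁻¹ {x} x≈0 with x ≈? 0#
  ... | yes _   = refl
  ... | no  x≉0 = contradiction x≈0 x≉0

  *-inverseʳ : ∀ {x} → x ≉ 0# → x * x ⁻¹ ≈ 1#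
  *-inverseʳ {x} x≉0 with x ≈? 0#
  ... | yes x≈0 = contradiction x≈0 x≉0
  ... | no  x≉0 = proj₂ (proj₂ (≉0⇒invertible x x≉0))

  *-inverseˡ : ∀ {x} → x ≉ 0# → x ⁻¹ * x ≈ 1#
  *-inverseˡ x≉0 = trans (*-comm _ _) (*-inverseʳ x≉0)

  x*y≈0⇒y≈0 : ∀ {x y} → x ≉ 0# → x * y ≈ 0# → y ≈ 0#
  x*y≈0⇒y≈0 {x} {y} x≉0 xy≈0 = begin
    y              ≈⟨ *-identityˡ y ⟨
    1# * y         ≈⟨ *-congʳ (*-inverseˡ x≉0) ⟨
    x ⁻¹ * x * y   ≈⟨ *-assoc _ _ _ ⟩
    x ⁻¹ * (x * y) ≈⟨ *-congˡ xy≈0 ⟩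
    x ⁻¹ * 0#      ≈⟨ zeroʳ _ ⟩
    0#             ∎

  *-≉0 : ∀ {x y} → x ≉ 0# → y ≉ 0# → x * y ≉ 0#
  *-≉0 x≉0 y≉0 = y≉0 ∘ x*y≈0⇒y≈0 x≉0

  x*y≈1⇒x≉0 : ∀ {x y} → x * y ≈ 1# → x ≉ 0#
  x*y≈1⇒x≉0 xy≈1 x≈0 = 0≉1 (trans (sym (zeroˡ _)) (trans (*-congʳ (sym x≈0)) xy≈1))

  ⁻¹-unique : ∀ {x y} → x * y ≈ 1# → y ≈ x ⁻¹
  ⁻¹-unique {x} {y} xy≈1 = begin
    y              ≈⟨ *-identityˡ y ⟨
    1# * y         ≈⟨ *-congʳ (*-inverseˡ (x*y≈1⇒x≉0 xy≈1)) ⟨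
    x ⁻¹ * x * y   ≈⟨ *-assoc _ _ _ ⟩
    x ⁻¹ * (x * y) ≈⟨ *-congˡ xy≈1 ⟩
    x ⁻¹ * 1#      ≈⟨ *-identityʳ _ ⟩
    x ⁻¹           ∎

  ⁻¹-cong : ∀ {x y} → x ≈ y → x ⁻¹ ≈ y ⁻¹
  ⁻¹-cong {x} {y} x≈y with x ≈? 0#
  ... | yes x≈0 = sym (0⁻¹ (trans (sym x≈y) x≈0))
  ... | no  x≉0 = ⁻¹-unique (trans (*-congʳ (sym x≈y)) (proj₂ (proj₂ (≉0⇒invertible x x≉0))))

  ⁻¹≉0 : ∀ x → x ⁻¹ ≉ 0#
  ⁻¹≉0 x with x ≈? 0#
  ... | yes _   = 0≉1 ∘ sym
  ... | no  x≉0 = x*y≈1⇒x≉0 (proj₁ (proj₂ (≉0⇒invertible x x≉0)))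

  ⁻¹-* : ∀ {x y} → x ≉ 0# → y ≉ 0# → (x * y) ⁻¹ ≈ x ⁻¹ * y ⁻¹
  ⁻¹-* {x} {y} x≉0 y≉0 = sym (⁻¹-unique (begin
    x * y * (x ⁻¹ * y ⁻¹)   ≈⟨ *-interchange _ _ _ _ ⟩
    x * x ⁻¹ * (y * y ⁻¹)   ≈⟨ *-cong (*-inverseʳ x≉0) (*-inverseʳ y≉0) ⟩
    1# * 1#                 ≈⟨ *-identityˡ 1# ⟩
    1#                      ∎))

  -≉0 : ∀ {x} → x ≉ 0# → - x ≉ 0#
  -≉0 x≉0 -x≈0 = x≉0 (trans (sym (-‿involutive _)) (trans (-‿cong -x≈0) -0#≈0#))

  -x*-y≈x*y : ∀ x y → - x * - y ≈ x * y
  -x*-y≈x*y x y = trans (sym (-‿distribˡ-* _ _)) (trans (-‿cong (sym (-‿distribʳ-* _ _))) (-‿involutive _))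

  ⁻¹-neg : ∀ {x} → x ≉ 0# → (- x) ⁻¹ ≈ - (x ⁻¹)
  ⁻¹-neg {x} x≉0 = sym (⁻¹-unique (trans (-x*-y≈x*y _ _) (*-inverseʳ x≉0)))

  module Sum = ListFold +-commutativeMonoid renaming
    ( fold to ∑; fold-cong to ∑-cong; fold-ε to ∑-zero; fold-++ to ∑-++; fold-map to ∑-map
    ; fold-↭ to ∑-↭; fold-∙ to ∑-+; fold-swap to ∑-swap)
  module Product = ListFold *-commutativeMonoid renaming
    ( fold to ∏; fold-cong to ∏-cong; fold-ε to ∏-one; fold-++ to ∏-++; fold-map to ∏-map
    ; fold-↭ to ∏-↭; fold-∙ to ∏-*; fold-update to ∏-update)
  open Sum using (∑; ∑-cong; ∑-zero; ∑-++; ∑-map; ∑-↭; ∑-+; ∑-swap) public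
  open Product using (∏; ∏-cong; ∏-one; ∏-++; ∏-map; ∏-↭; ∏-*; ∏-update) public

  module _ {i} {I : Set i} where

    *-∑ : ∀ x (f : I → Carrier) xs → x * ∑ f xs ≈ ∑ (λ i → x * f i) xs
    *-∑ x f []       = zeroʳ x
    *-∑ x f (i ∷ xs) = trans (distribˡ x _ _) (+-congˡ (*-∑ x f xs))

    ∑-const : ∀ {f : I → Carrier} x xs → (∀ {i} → i ∈ xs → f i ≈ x) → ∑ f xs ≈ length xs · x
    ∑-const x []       f≈x = refl
    ∑-const x (i ∷ xs) f≈x = +-cong (f≈x (here ≡.refl)) (∑-const x xs (f≈x ∘ there))

    ∏-const : ∀ {f : I → Carrier} x xs → (∀ {i} → i ∈ xs → f i ≈ x) → ∏ f xs ≈ x ^ length xs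
    ∏-const x []       f≈x = refl
    ∏-const x (i ∷ xs) f≈x = *-cong (f≈x (here ≡.refl)) (∏-const x xs (f≈x ∘ there))

    ∏-≉0 : ∀ {f : I → Carrier} xs → (∀ {i} → i ∈ xs → f i ≉ 0#) → ∏ f xs ≉ 0#
    ∏-≉0 []       f≉0 = 0≉1 ∘ sym
    ∏-≉0 (i ∷ xs) f≉0 = *-≉0 (f≉0 (here ≡.refl)) (∏-≉0 xs (f≉0 ∘ there))

  telescope : ∀ x y z → x - z ≈ (x - y) + (y - z)
  telescope x y z = sym (begin
    (x - y) + (y - z)     ≈⟨ +-assoc _ _ _ ⟩
    x + (- y + (y - z))   ≈⟨ +-congˡ (+-assoc _ _ _) ⟨
    x + ((- y + y) - z)   ≈⟨ +-congˡ (+-congʳ (-‿inverseˡ y)) ⟩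
    x + (0# - z)          ≈⟨ +-congˡ (+-identityˡ _) ⟩
    x - z                 ∎)

  x≉y⇒x-y≉0 : ∀ {x y} → x ≉ y → x - y ≉ 0#
  x≉y⇒x-y≉0 x≉y = x≉y ∘ x∙y⁻¹≈ε⇒x≈y _ _

  -- Divided differences of monic polynomials given by their roots.

  module DividedDifference {i} {I : Set i} (m : I → Carrier) where

    -- The divided difference of ∏_{w ∈ W} (X - w) at the nodes m a, a ∈ P; the
    -- factor z = a of the second product is 0⁻¹ = 1.
    dd : List Carrier → List I → Carrier
    dd W P = ∑ (λ a → ∏ (λ w → m a - w) W * ∏ (λ z → (m a - m z) ⁻¹) P) P

    Distinct : List I → Set _
    Distinct P = ∀ {a b} → a ∈ P → b ∈ P → a ≢ b → m a ≉ m b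

    dd-↭ : ∀ W {P P′} → P ↭ P′ → dd W P ≈ dd W P′
    dd-↭ W {P} {P′} p = trans (∑-cong P (λ _ → *-congˡ (∏-↭ _ p))) (∑-↭ _ p)

    -- Write X - w = (X - m p) + (m p - w). The factor X - m p kills the summand at `p` and cancels
    -- the node `p` from all the others.
    dd-∷ : ∀ w W p P → Uniqueₚ (p ∷ P) → Distinct (p ∷ P) →
           dd (w ∷ W) (p ∷ P) ≈ dd W P + (m p - w) * dd W (p ∷ P)
    dd-∷ w W p P (p∉P ∷ _) dis = begin
      dd (w ∷ W) (p ∷ P)
        ≈⟨ ∑-cong (p ∷ P) (λ {a} _ → split a) ⟩
      ∑ (λ a → (m a - m p) * (T a * Q a) + (m p - w) * (T a * Q a)) (p ∷ P)
        ≈⟨ ∑-+ _ _ (p ∷ P) ⟩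
      (m p - m p) * (T p * Q p) + ∑ (λ a → (m a - m p) * (T a * Q a)) P + ∑ (λ a → (m p - w) * (T a * Q a)) (p ∷ P)
        ≈⟨ +-cong (+-cong (trans (*-congʳ (-‿inverseʳ _)) (zeroˡ _)) (∑-cong P cancel)) (sym (*-∑ _ _ (p ∷ P))) ⟩
      0# + dd W P + (m p - w) * dd W (p ∷ P)
        ≈⟨ +-congʳ (+-identityˡ _) ⟩
      dd W P + (m p - w) * dd W (p ∷ P) ∎
      where
      T Q : I → Carrier
      T a = ∏ (λ w → m a - w) W
      Q a = ∏ (λ z → (m a - m z) ⁻¹) (p ∷ P)
      split : ∀ a → (m a - w) * T a * Q a ≈ (m a - m p) * (T a * Q a) + (m p - w) * (T a * Q a)
      split a = trans (*-assoc _ _ _) (trans (*-congʳ (telescope (m a) (m p) w)) (distribʳ _ _ _))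
      cancel : ∀ {a} → a ∈ P → (m a - m p) * (T a * Q a) ≈ T a * ∏ (λ z → (m a - m z) ⁻¹) P
      cancel {a} a∈P = begin
        (m a - m p) * (T a * ((m a - m p) ⁻¹ * R)) ≈⟨ x*yz≈y*xz _ _ _ ⟩
        T a * ((m a - m p) * ((m a - m p) ⁻¹ * R)) ≈⟨ *-congˡ (*-assoc _ _ _) ⟨
        T a * ((m a - m p) * (m a - m p) ⁻¹ * R)   ≈⟨ *-congˡ (*-congʳ (*-inverseʳ (x≉y⇒x-y≉0
                                                       (dis (there a∈P) (here ≡.refl) (All.lookup p∉P a∈P ∘ ≡.sym))))) ⟩
        T a * (1# * R)                             ≈⟨ *-congˡ (*-identityˡ R) ⟩
        T a * R                                    ∎
        where R = ∏ (λ z → (m a - m z) ⁻¹) P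

    dd-node : ∀ p P → Uniqueₚ (p ∷ P) → Distinct (p ∷ P) → dd (m p ∷ []) (p ∷ P) ≈ dd [] P
    dd-node p P u dis = begin
      dd (m p ∷ []) (p ∷ P)                   ≈⟨ dd-∷ (m p) [] p P u dis ⟩
      dd [] P + (m p - m p) * dd [] (p ∷ P)   ≈⟨ +-congˡ (trans (*-congʳ (-‿inverseʳ _)) (zeroˡ _)) ⟩
      dd [] P + 0#                            ≈⟨ +-identityʳ _ ⟩
      dd [] P                                 ∎

    dd-[p] : ∀ p → dd [] (p ∷ []) ≈ 1#
    dd-[p] p = begin
      1# * ((m p - m p) ⁻¹ * 1#) + 0# ≈⟨ +-identityʳ _ ⟩
      1# * ((m p - m p) ⁻¹ * 1#)      ≈⟨ *-identityˡ _ ⟩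
      (m p - m p) ⁻¹ * 1#             ≈⟨ *-identityʳ _ ⟩
      (m p - m p) ⁻¹                  ≈⟨ 0⁻¹ (-‿inverseʳ _) ⟩
      1#                              ∎

    -- Expanding the divided difference of X - m p′ with pivot `p` and with pivot `p′` gives the
    -- classical recursion: m p - m p′ times the left side is `dd [] (p ∷ P)` minus
    -- `dd [] (p′ ∷ P)`. These two agree, being both 1 for empty `P` and both 0 otherwise.
    dd-[]-vanishes : ∀ p p′ P → Uniqueₚ (p ∷ p′ ∷ P) → Distinct (p ∷ p′ ∷ P) → dd [] (p ∷ p′ ∷ P) ≈ 0#
    dd-[]-vanishes p p′ P u@((p≢p′ ∷ p∉P) ∷ (p′∉P ∷ u′)) dis =
      x*y≈0⇒y≈0 (x≉y⇒x-y≉0 (dis (here ≡.refl) (there (here ≡.refl)) p≢p′))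
        (∙-cancelˡ (dd [] (p′ ∷ P)) _ _ (begin
          dd [] (p′ ∷ P) + (m p - m p′) * dd [] (p ∷ p′ ∷ P) ≈⟨ dd-∷ (m p′) [] p (p′ ∷ P) u dis ⟨
          dd (m p′ ∷ []) (p ∷ p′ ∷ P)                        ≈⟨ dd-↭ (m p′ ∷ []) {p ∷ p′ ∷ P} (swap p p′ ↭-refl) ⟩
          dd (m p′ ∷ []) (p′ ∷ p ∷ P)                        ≈⟨ dd-node p′ (p ∷ P) ((p≢p′ ∘ ≡.sym ∷ p′∉P) ∷ (p∉P ∷ u′))
                                                                  (λ a∈ b∈ → dis (flip∈ a∈) (flip∈ b∈)) ⟩
          dd [] (p ∷ P)                                      ≈⟨ same P p∉P p′∉P u′ dis ⟩
          dd [] (p′ ∷ P)                                     ≈⟨ +-identityʳ _ ⟨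
          dd [] (p′ ∷ P) + 0#                                ∎))
      where
      flip∈ : ∀ {a} → a ∈ p′ ∷ p ∷ P → a ∈ p ∷ p′ ∷ P
      flip∈ = ∈-resp-↭ (swap p′ p ↭-refl)
      same : ∀ P → All (p ≢_) P → All (p′ ≢_) P → Uniqueₚ P → Distinct (p ∷ p′ ∷ P) →
             dd [] (p ∷ P) ≈ dd [] (p′ ∷ P)
      same []       _   _    _ _   = trans (dd-[p] p) (sym (dd-[p] p′))
      same (r ∷ P) p∉P p′∉P u dis = trans
        (dd-[]-vanishes p r P (p∉P ∷ u) (λ a∈ b∈ → dis (omit′ a∈) (omit′ b∈)))
        (sym (dd-[]-vanishes p′ r P (p′∉P ∷ u) (λ a∈ b∈ → dis (there a∈) (there b∈))))
        where
        omit′ : ∀ {a} → a ∈ p ∷ r ∷ P → a ∈ p ∷ p′ ∷ r ∷ P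
        omit′ (here e)  = here e
        omit′ (there a∈) = there (there a∈)

    -- In `dd-∷` both terms on the right lose a root and at most one node, so the degree stays below
    -- the order of the divided difference.
    dd-vanishes : ∀ W P → Uniqueₚ P → Distinct P → suc (length W) < length P → dd W P ≈ 0#
    dd-vanishes []      (p ∷ p′ ∷ P) u dis _ = dd-[]-vanishes p p′ P u dis
    dd-vanishes (w ∷ W) (p ∷ P) u@(_ ∷ u′) dis (s≤s lt) = begin
      dd (w ∷ W) (p ∷ P)                ≈⟨ dd-∷ w W p P u dis ⟩
      dd W P + (m p - w) * dd W (p ∷ P) ≈⟨ +-cong (dd-vanishes W P u′ (λ a∈ b∈ → dis (there a∈) (there b∈)) lt)
                                                  (*-congˡ (dd-vanishes W (p ∷ P) u dis (ℕ.m<n⇒m<1+n lt))) ⟩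
      0# + (m p - w) * 0#               ≈⟨ trans (+-identityˡ _) (zeroʳ _) ⟩
      0#                                ∎
    dd-vanishes [] (p ∷ []) _ _ (s≤s ())

    -- The leading coefficient of a monic polynomial: in `dd-∷` the term with all nodes has too
    -- small a degree and vanishes, and the other one continues the induction.
    dd-leading : ∀ W P → Uniqueₚ P → Distinct P → length P ≡ suc (length W) → dd W P ≈ 1#
    dd-leading []      (p ∷ [])  _ _   _  = dd-[p] p
    dd-leading (w ∷ W) (p ∷ P) u@(_ ∷ u′) dis eq = begin
      dd (w ∷ W) (p ∷ P)                ≈⟨ dd-∷ w W p P u dis ⟩
      dd W P + (m p - w) * dd W (p ∷ P) ≈⟨ +-cong (dd-leading W P u′ (λ a∈ b∈ → dis (there a∈) (there b∈)) (ℕ.suc-injective eq))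
                                                  (*-congˡ (dd-vanishes W (p ∷ P) u dis (ℕ.≤-reflexive (≡.sym eq)))) ⟩
      1# + (m p - w) * 0#               ≈⟨ trans (+-congˡ (zeroʳ _)) (+-identityʳ _) ⟩
      1#                                ∎

  -- Theorems of Fermat and Wilson, and the characteristic.

  elements : List (Fin q)
  elements = allFin q

  length-elements : length elements ≡ q
  length-elements = length-tabulate id

  from∘to : (Carrier → Carrier) → Fin q → Fin q
  from∘to f i = to (f (from i))

  elements-↭-map : ∀ f → (∀ {x y} → f x ≈ f y → x ≈ y) → elements ↭ map (from∘to f) elements
  elements-↭-map f inj = unique-⊆-length⇒↭
    (Unique.map⁺ (from-injective ∘ inj ∘ to-injective) (Unique.allFin⁺ q))
    (λ _ → ∈-allFin _) (length-map _ elements)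

  ∑-reindex : ∀ (g f : Carrier → Carrier) → (∀ {x y} → g x ≈ g y → x ≈ y) → (∀ {x y} → x ≈ y → f x ≈ f y) →
              ∑ (f ∘ from) elements ≈ ∑ (f ∘ g ∘ from) elements
  ∑-reindex g f inj f-cong = trans (∑-↭ _ (elements-↭-map g inj)) (trans (∑-map _ _ elements)
    (∑-cong elements (λ _ → f-cong (strictlyInverseʳ _))))

  ∏-reindex : ∀ (g f : Carrier → Carrier) → (∀ {x y} → g x ≈ g y → x ≈ y) → (∀ {x y} → x ≈ y → f x ≈ f y) →
              ∏ (f ∘ from) elements ≈ ∏ (f ∘ g ∘ from) elements
  ∏-reindex g f inj f-cong = trans (∏-↭ _ (elements-↭-map g inj)) (trans (∏-map _ _ elements)
    (∏-cong elements (λ _ → f-cong (strictlyInverseʳ _))))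

  -- Translation by 1 permutes the field, so adding 1 to every element leaves the sum of all
  -- elements unchanged.
  q·1≈0 : q · 1# ≈ 0#
  q·1≈0 = sym (∙-cancelˡ (∑ from elements) _ _ (begin
    ∑ from elements + 0#                        ≈⟨ +-identityʳ _ ⟩
    ∑ from elements                             ≈⟨ ∑-reindex (1# +_) id (λ {x} {y} → ∙-cancelˡ 1# x y) id ⟩
    ∑ (λ i → 1# + from i) elements              ≈⟨ ∑-+ _ _ elements ⟩
    ∑ (λ _ → 1#) elements + ∑ from elements     ≈⟨ +-congʳ (∑-const 1# elements (λ _ → refl)) ⟩
    length elements · 1# + ∑ from elements      ≈⟨ +-congʳ (×-congˡ length-elements) ⟩
    q · 1# + ∑ from elements                    ≈⟨ +-comm _ _ ⟩
    ∑ from elements + q · 1#                    ∎))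

  nonzeros : List (Fin q)
  nonzeros = proj₁ (∈⇒↭∷ (∈-allFin (to 0#)))

  elements-↭ : elements ↭ to 0# ∷ nonzeros
  elements-↭ = proj₂ (∈⇒↭∷ (∈-allFin (to 0#)))

  q≡1+nonzeros : q ≡ suc (length nonzeros)
  q≡1+nonzeros = ≡.trans (≡.sym length-elements) (↭-length elements-↭)

  nonzeros-≉0 : ∀ {i} → i ∈ nonzeros → from i ≉ 0#
  nonzeros-≉0 i∈ e with u ∷ _ ← Unique-resp-↭ elements-↭ (Unique.allFin⁺ q) =
    All.lookup u i∈ (≡.trans (to-cong (sym e)) (strictlyInverseˡ _))

  *-cancelˡ-≉0 : ∀ {x y z} → x ≉ 0# → x * y ≈ x * z → y ≈ z
  *-cancelˡ-≉0 {x} {y} {z} x≉0 e = begin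
    y              ≈⟨ *-identityˡ y ⟨
    1# * y         ≈⟨ *-congʳ (*-inverseˡ x≉0) ⟨
    x ⁻¹ * x * y   ≈⟨ *-assoc _ _ _ ⟩
    x ⁻¹ * (x * y) ≈⟨ *-congˡ e ⟩
    x ⁻¹ * (x * z) ≈⟨ *-assoc _ _ _ ⟨
    x ⁻¹ * x * z   ≈⟨ *-congʳ (*-inverseˡ x≉0) ⟩
    1# * z         ≈⟨ *-identityˡ z ⟩
    z              ∎

  -- Stated for inverses because of 0⁻¹ = 1: the product of all y⁻¹ can run over the whole field,
  -- which multiplication by `x` permutes, and the factor at 0 drops out.
  fermat⁻¹ : ∀ {x} → x ≉ 0# → x ⁻¹ ^ length nonzeros ≈ 1#
  fermat⁻¹ {x} x≉0 = *-cancelˡ-≉0 (∏-≉0 nonzeros (λ {i} _ → ⁻¹≉0 (from i))) (begin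
    w * x ⁻¹ ^ length nonzeros                       ≈⟨ *-comm _ _ ⟩
    x ⁻¹ ^ length nonzeros * w                       ≈⟨ *-congʳ (∏-const (x ⁻¹) nonzeros (λ _ → refl)) ⟨
    ∏ (λ _ → x ⁻¹) nonzeros * w                      ≈⟨ ∏-* _ _ nonzeros ⟨
    ∏ (λ i → x ⁻¹ * from i ⁻¹) nonzeros              ≈⟨ ∏-cong nonzeros (λ i∈ → ⁻¹-* x≉0 (nonzeros-≉0 i∈)) ⟨
    ∏ (λ i → (x * from i) ⁻¹) nonzeros               ≈⟨ drop-zero (λ i → (x * from i) ⁻¹) (0⁻¹ (trans (*-congˡ (strictlyInverseʳ 0#)) (zeroʳ x))) ⟨
    ∏ (λ i → (x * from i) ⁻¹) elements               ≈⟨ ∏-reindex (x *_) _⁻¹ (*-cancelˡ-≉0 x≉0) ⁻¹-cong ⟨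
    ∏ (λ i → from i ⁻¹) elements                     ≈⟨ drop-zero (λ i → from i ⁻¹) (0⁻¹ (strictlyInverseʳ 0#)) ⟩
    w                                                ≈⟨ *-identityʳ w ⟨
    w * 1#                                           ∎)
    where
    w = ∏ (λ i → from i ⁻¹) nonzeros
    drop-zero : ∀ f → f (to 0#) ≈ 1# → ∏ f elements ≈ ∏ f nonzeros
    drop-zero f e = trans (∏-↭ f elements-↭) (trans (*-congʳ e) (*-identityˡ _))

  fermat : ∀ {x} → x ≉ 0# → x ^ length nonzeros ≈ 1#
  fermat {x} x≉0 = trans (^-congˡ (length nonzeros) (⁻¹-unique (*-inverseˡ x≉0))) (fermat⁻¹ (⁻¹≉0 x))

  module _ (1<q : 1 < q) where

    -- Wilson's theorem, read off from the leading coefficient of X^(q-1).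
    wilson : ∀ x → ∏ (λ i → (x - from i) ⁻¹) elements ≈ - 1#
    wilson x = begin
      ∏ (λ i → (x - from i) ⁻¹) elements   ≈⟨ invariant x ⟩
      w                                    ≈⟨ *-identityˡ w ⟨
      1# * w                               ≈⟨ *-congʳ (inverseʳ-unique _ _ n·1+1≈0) ⟩
      - (n · 1#) * w                       ≈⟨ -‿distribˡ-* _ _ ⟨
      - (n · 1# * w)                       ≈⟨ -‿cong n·1*w≈1 ⟩
      - 1#                                 ∎
      where
      n = length nonzeros
      w = ∏ (λ i → (0# - from i) ⁻¹) elements
      n·1+1≈0 : n · 1# + 1# ≈ 0#
      n·1+1≈0 = trans (+-comm _ _) (trans (×-congˡ (≡.sym q≡1+nonzeros)) q·1≈0)
      invariant : ∀ y → ∏ (λ i → (y - from i) ⁻¹) elements ≈ w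
      invariant y = trans (∏-reindex (y +_) (λ z → (y - z) ⁻¹) (λ {x} {z} → ∙-cancelˡ y x z) (⁻¹-cong ∘ +-congˡ ∘ -‿cong))
        (∏-cong elements (λ {i} _ → ⁻¹-cong (begin
          y - (y + from i)       ≈⟨ +-congˡ (-‿+-comm _ _) ⟨
          y + (- y - from i)     ≈⟨ +-assoc _ _ _ ⟨
          y - y - from i         ≈⟨ +-congʳ (-‿inverseʳ y) ⟩
          0# - from i            ∎)))
      open DividedDifference from
      power : ∀ i → ∏ (λ z → from i - z) (replicate n 0#) ≈ from i ^ n
      power i = trans (∏-const (from i) (replicate n 0#) (λ z∈ → trans
                  (+-congˡ (trans (-‿cong (reflexive (∈-replicate n z∈))) -0#≈0#)) (+-identityʳ _)))
                  (^-congʳ (from i) (length-replicate n))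
        where
        ∈-replicate : ∀ n {z} → z ∈ replicate n 0# → z ≡ 0#
        ∈-replicate (suc n) (here e)   = e
        ∈-replicate (suc n) (there z∈) = ∈-replicate n z∈
      0^n≈0 : ∀ n → 1 < suc n → from (to 0#) ^ n ≈ 0#
      0^n≈0 (suc n) _ = trans (*-congʳ (strictlyInverseʳ 0#)) (zeroˡ _)
      0^n≈0 zero (s≤s ())
      n·1*w≈1 : n · 1# * w ≈ 1#
      n·1*w≈1 = begin
        n · 1# * w                              ≈⟨ *-congʳ (∑-const 1# nonzeros (λ i∈ → fermat (nonzeros-≉0 i∈))) ⟨
        ∑ (λ i → from i ^ n) nonzeros * w       ≈⟨ *-congʳ (+-identityˡ _) ⟨
        (0# + ∑ (λ i → from i ^ n) nonzeros) * w
          ≈⟨ *-congʳ (+-congʳ (0^n≈0 n (≡.subst (1 <_) q≡1+nonzeros 1<q))) ⟨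
        ∑ (λ i → from i ^ n) (to 0# ∷ nonzeros) * w ≈⟨ *-congʳ (∑-↭ _ elements-↭) ⟨
        ∑ (λ i → from i ^ n) elements * w       ≈⟨ *-comm _ _ ⟩
        w * ∑ (λ i → from i ^ n) elements       ≈⟨ *-∑ w _ elements ⟩
        ∑ (λ i → w * from i ^ n) elements       ≈⟨ ∑-cong elements (λ {i} _ → trans (*-comm _ _)
                                                     (*-cong (sym (power i)) (sym (invariant (from i))))) ⟩
        dd (replicate n 0#) elements            ≈⟨ dd-leading (replicate n 0#) elements (Unique.allFin⁺ q) (λ _ _ i≢j → i≢j ∘ from-injective)
                                                     (≡.trans length-elements (≡.trans q≡1+nonzeros (≡.cong suc (≡.sym (length-replicate n))))) ⟩
        1#                                      ∎

  module _ {p h} (p-prime : Prime p) (q≡p^h : q ≡ p ℕ.^ h) where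

    -- Multiples of 1 multiply like integers, so q · 1 is the h-th power of p · 1, and a field has
    -- no nilpotent elements except 0.
    p·1≈0 : p · 1# ≈ 0#
    p·1≈0 with p · 1# ≈? 0#
    ... | yes e = e
    ... | no ne = contradiction (trans (×-congˡ (≡.sym q≡p^h)) q·1≈0) (power≉0 h)
      where
      power≉0 : ∀ h → (p ℕ.^ h) · 1# ≉ 0#
      power≉0 zero    e = 0≉1 (sym (trans (sym (+-identityʳ _)) e))
      power≉0 (suc h) e = *-≉0 ne (power≉0 h) (trans (sym (×1-homo-* p (p ℕ.^ h))) e)

    private
      absurd : ∀ {m n} x y → n · 1# ≈ 0# → m · 1# ≈ 0# → ¬ 1 ℕ.+ y ℕ.* n ≡ x ℕ.* m
      absurd {m} {n} x y n·1≈0 m·1≈0 eq = 0≉1 (begin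
        0#                          ≈⟨ trans (×1-homo-* x m) (trans (*-congˡ m·1≈0) (zeroʳ _)) ⟨
        (x ℕ.* m) · 1#              ≈⟨ ×-congˡ eq ⟨
        1# + (y ℕ.* n) · 1#         ≈⟨ +-congˡ (trans (×1-homo-* y n) (trans (*-congˡ n·1≈0) (zeroʳ _))) ⟩
        1# + 0#                     ≈⟨ +-identityʳ 1# ⟩
        1#                          ∎)

    -- A Bézout identity for the coprime numbers n and p would turn n · 1 = p · 1 = 0 into 1 = 0.
    -- Through this lemma the bound k ≤ p makes r! invertible.
    ·1≉0 : ∀ n .{{_ : ℕ.NonZero n}} → n < p → n · 1# ≉ 0#
    ·1≉0 n n<p n·1≈0 with coprime-Bézout (prime⇒coprime p-prime n<p)
    ... | Bézout.+- x y eq = absurd x y n·1≈0 p·1≈0 eq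
    ... | Bézout.-+ x y eq = absurd y x p·1≈0 n·1≈0 eq

-- The vanishing sum on a projective line.

module Planar {c ℓ} (F : Field c ℓ) (q : ℕ) (size : HasSize (Field.setoid F) q) (1<q : 1 < q) where

  open FiniteField F q size
  open import Relation.Binary.Reasoning.Setoid setoid
  open import Algebra.Solver.CommutativeMonoid *-commutativeMonoid using (solve; _⊜_; _⊕_)

  -- Inversion does not commute with negation at 0, where both inverses are 1, but the squares agree
  -- everywhere.
  [-x]⁻¹² : ∀ x → (- x) ⁻¹ * (- x) ⁻¹ ≈ x ⁻¹ * x ⁻¹
  [-x]⁻¹² x = by-cases (x ≈? 0#)
    where
    by-cases : Dec (x ≈ 0#) → (- x) ⁻¹ * (- x) ⁻¹ ≈ x ⁻¹ * x ⁻¹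
    by-cases (yes x≈0) = *-cong e e
      where e = ⁻¹-cong (trans (-‿cong x≈0) (trans -0#≈0# (sym x≈0)))
    by-cases (no x≉0) = trans (*-cong (⁻¹-neg x≉0) (⁻¹-neg x≉0)) (-x*-y≈x*y _ _)

  -- The bracket of two points x (1 , m) and x′ (1 , m′) of F² is x x′ (m′ - m).
  module _ {i} {I : Set i} (br : I → I → Carrier) (x y : I → Carrier)
    (z₀ : I) (X O : List I) (unique : Uniqueₚ (z₀ ∷ X ++ O))
    (br-xy : ∀ {a b} → a ∈ z₀ ∷ X ++ O → b ∈ z₀ ∷ X ++ O → br a b ≈ x a * y b - x b * y a)
    (br≉0 : ∀ {a b} → a ∈ z₀ ∷ X ++ O → b ∈ z₀ ∷ X ++ O → a ≢ b → br a b ≉ 0#)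
    (x-z₀ : x z₀ ≈ 0#)
    (count : length (z₀ ∷ X) ℕ.+ length (z₀ ∷ X) ℕ.+ length O ≡ q ℕ.+ 3)
    where

    private
      M : List I
      M = X ++ O

      n = length nonzeros

      uM : Uniqueₚ M
      uM = proj₂ (unique-++⁻ (z₀ ∷ []) unique)

      z₀≢ : ∀ {a} → a ∈ M → a ≢ z₀
      z₀≢ a∈ = unique-++-disjoint {xs = z₀ ∷ []} unique (here ≡.refl) a∈ ∘ ≡.sym

      X⊆M : ∀ {a} → a ∈ X → a ∈ M
      X⊆M = ∈-++⁺ˡ

      O⊆M : ∀ {a} → a ∈ O → a ∈ M
      O⊆M = ∈-++⁺ʳ X

      br-az₀ : ∀ {a} → a ∈ M → br a z₀ ≈ x a * y z₀
      br-az₀ {a} a∈ = begin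
        br a z₀                   ≈⟨ br-xy (there a∈) (here ≡.refl) ⟩
        x a * y z₀ - x z₀ * y a   ≈⟨ +-congˡ (-‿cong (trans (*-congʳ x-z₀) (zeroˡ _))) ⟩
        x a * y z₀ - 0#           ≈⟨ trans (+-congˡ -0#≈0#) (+-identityʳ _) ⟩
        x a * y z₀                ∎

      br-z₀a : ∀ {a} → a ∈ M → br z₀ a ≈ - (x a * y z₀)
      br-z₀a {a} a∈ = begin
        br z₀ a                   ≈⟨ br-xy (here ≡.refl) (there a∈) ⟩
        x z₀ * y a - x a * y z₀   ≈⟨ +-congʳ (trans (*-congʳ x-z₀) (zeroˡ _)) ⟩
        0# - x a * y z₀           ≈⟨ +-identityˡ _ ⟩
        - (x a * y z₀)            ∎

      br-z₀z₀ : br z₀ z₀ ≈ 0#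
      br-z₀z₀ = trans (br-xy (here ≡.refl) (here ≡.refl)) (-‿inverseʳ _)

      xy₀≉0 : ∀ {a} → a ∈ M → x a * y z₀ ≉ 0#
      xy₀≉0 a∈ = br≉0 (there a∈) (here ≡.refl) (z₀≢ a∈) ∘ trans (br-az₀ a∈)

      x≉0 : ∀ {a} → a ∈ M → x a ≉ 0#
      x≉0 a∈ e = xy₀≉0 a∈ (trans (*-congʳ e) (zeroˡ _))

      -- The affine coordinate on the line when `z₀` is the point at infinity.
      m : I → Carrier
      m a = y a * x a ⁻¹

      y≈xm : ∀ {a} → a ∈ M → y a ≈ x a * m a
      y≈xm {a} a∈ = begin
        y a                  ≈⟨ *-identityʳ _ ⟨
        y a * 1#             ≈⟨ *-congˡ (*-inverseʳ (x≉0 a∈)) ⟨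
        y a * (x a * x a ⁻¹) ≈⟨ x*yz≈y*xz _ _ _ ⟩
        x a * (y a * x a ⁻¹) ∎

      br-m : ∀ {a b} → a ∈ M → b ∈ M → br a b ≈ x a * (x b * (m b - m a))
      br-m {a} {b} a∈ b∈ = begin
        br a b                                       ≈⟨ br-xy (there a∈) (there b∈) ⟩
        x a * y b - x b * y a                        ≈⟨ +-cong (*-congˡ (y≈xm b∈)) (-‿cong (*-congˡ (y≈xm a∈))) ⟩
        x a * (x b * m b) - x b * (x a * m a)        ≈⟨ +-congˡ (-‿cong (x*yz≈y*xz _ _ _)) ⟩
        x a * (x b * m b) - x a * (x b * m a)        ≈⟨ +-congˡ (-‿distribʳ-* _ _) ⟩
        x a * (x b * m b) + x a * - (x b * m a)      ≈⟨ distribˡ _ _ _ ⟨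
        x a * (x b * m b - x b * m a)                ≈⟨ *-congˡ (+-congˡ (-‿distribʳ-* _ _)) ⟩
        x a * (x b * m b + x b * - m a)              ≈⟨ *-congˡ (distribˡ _ _ _) ⟨
        x a * (x b * (m b - m a))                    ∎

      open DividedDifference m

      m-distinct : Distinct M
      m-distinct {a} {b} a∈ b∈ a≢b e = br≉0 (there a∈) (there b∈) a≢b (begin
        br a b                      ≈⟨ br-m a∈ b∈ ⟩
        x a * (x b * (m b - m a))   ≈⟨ *-congˡ (*-congˡ (x≈y⇒x∙y⁻¹≈ε (sym e))) ⟩
        x a * (x b * 0#)            ≈⟨ trans (*-congˡ (zeroʳ _)) (zeroʳ _) ⟩
        0#                          ∎)

      slopes : List (Fin q)
      slopes = map (to ∘ m) M

      slopes-unique : ∀ L → Uniqueₚ L → Distinct L → Uniqueₚ (map (to ∘ m) L)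
      slopes-unique []      _       _   = []
      slopes-unique (a ∷ L) (d ∷ u) dis =
        All.map⁺ (All.tabulate λ b∈ e → dis (here ≡.refl) (there b∈) (All.lookup d b∈) (to-injective e))
        ∷ slopes-unique L u (λ a∈ b∈ → dis (there a∈) (there b∈))

      missing : ∃ λ W → elements ↭ slopes ++ W
      missing = unique-⊆⇒↭++ (slopes-unique M uM m-distinct) (λ _ → ∈-allFin _)

      W : List (Fin q)
      W = proj₁ missing

      q≡ : q ≡ length X ℕ.+ length O ℕ.+ length W
      q≡ = ≡.trans (≡.sym length-elements) (≡.trans (↭-length (proj₂ missing))
        (≡.trans (length-++ slopes) (≡.cong (ℕ._+ length W) (≡.trans (length-map _ M) (length-++ X)))))

      count′ : length X ℕ.+ length X ℕ.+ length O ≡ suc q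
      count′ = ℕ.+-cancelˡ-≡ 2 _ _ (≡.trans (≡.cong (λ k → suc (k ℕ.+ length O)) (≡.sym (ℕ.+-suc (length X) (length X)))) (≡.trans count (ℕ.+-comm q 3)))

      -- The slopes give |X| + |O| + |W| = q, and the size of the arc gives 2|X| + |O| = q + 1. This
      -- balance makes `T` a polynomial of degree one less than its number of nodes in `X`. For
      -- empty `X` it is absurd: q + 2 points do not fit on the line.
      count-W : length X ≡ suc (length W)
      count-W = ℕ.+-cancelˡ-≡ (length X ℕ.+ length O) _ _ (≡.trans
        (≡.trans (ℕ.+-assoc (length X) _ _) (≡.trans (≡.cong (length X ℕ.+_) (ℕ.+-comm (length O) _)) (≡.sym (ℕ.+-assoc (length X) _ _))))
        (≡.trans count′ (≡.trans (≡.cong suc q≡) (≡.sym (ℕ.+-suc (length X ℕ.+ length O) _)))))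

      T : I → Carrier
      T a = ∏ (λ w → m a - w) (map from W)

      δ : I → I → Carrier
      δ a z = (m a - m z) ⁻¹

      -- Wilson's theorem trades the product over the occupied slopes for the
      -- polynomial T vanishing at the missing ones.
      ∏δ≈-T : ∀ {a} → a ∈ M → ∏ (δ a) X * ∏ (δ a) O ≈ - T a
      ∏δ≈-T {a} a∈ = begin
        ∏ (δ a) X * ∏ (δ a) O                     ≈⟨ ∏-++ _ X O ⟨
        ∏ (δ a) M                                 ≈⟨ *-identityʳ _ ⟨
        ∏ (δ a) M * 1#                            ≈⟨ *-congˡ cancel ⟨
        ∏ (δ a) M * (∏ ε⁻¹ W * T a)               ≈⟨ *-assoc _ _ _ ⟨
        ∏ (δ a) M * ∏ ε⁻¹ W * T a                 ≈⟨ *-congʳ (*-congʳ (trans (∏-map _ _ M)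
                                                       (∏-cong M λ _ → ⁻¹-cong (+-congˡ (-‿cong (strictlyInverseʳ _)))))) ⟨
        ∏ ε⁻¹ slopes * ∏ ε⁻¹ W * T a              ≈⟨ *-congʳ (∏-++ _ slopes W) ⟨
        ∏ ε⁻¹ (slopes ++ W) * T a                 ≈⟨ *-congʳ (∏-↭ _ (proj₂ missing)) ⟨
        ∏ ε⁻¹ elements * T a                      ≈⟨ *-congʳ (wilson 1<q (m a)) ⟩
        - 1# * T a                                ≈⟨ -‿distribˡ-* _ _ ⟨
        - (1# * T a)                              ≈⟨ -‿cong (*-identityˡ _) ⟩
        - T a                                     ∎
        where
        ε⁻¹ : Fin q → Carrier
        ε⁻¹ w = (m a - from w) ⁻¹
        uW : Uniqueₚ (slopes ++ W)
        uW = Unique-resp-↭ (proj₂ missing) (Unique.allFin⁺ q)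
        ε≉0 : ∀ {w} → w ∈ W → m a - from w ≉ 0#
        ε≉0 {w} w∈ e = unique-++-disjoint uW (∈-map⁺ (to ∘ m) a∈) w∈
          (≡.trans (to-cong (x∙y⁻¹≈ε⇒x≈y _ _ e)) (strictlyInverseˡ w))
        cancel : ∏ ε⁻¹ W * T a ≈ 1#
        cancel = trans (*-congˡ (∏-map _ _ W)) (trans (sym (∏-* _ _ W)) (∏-one W (*-inverseˡ ∘ ε≉0)))

      ∏-scaled : ∀ (p d : I → Carrier) u L →
                 ∏ (λ z → p z * (u * d z)) L ≈ ∏ p L * (u ^ length L * ∏ d L)
      ∏-scaled p d u L = trans (∏-* _ _ L) (*-congˡ (trans (∏-* _ _ L) (*-congʳ (∏-const u L (λ _ → refl)))))

      -- The exponents add up to q + 1 = 2 + (q - 1), and Fermat removes q - 1.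
      power : ∀ {u} → u ≉ 0# →
              u ⁻¹ ^ length X * u ⁻¹ ^ length X * u ⁻¹ ^ length O ≈ u ⁻¹ * u ⁻¹
      power {u} u≉0 = begin
        u ⁻¹ ^ length X * u ⁻¹ ^ length X * u ⁻¹ ^ length O   ≈⟨ *-congʳ (^-homo-* _ (length X) (length X)) ⟨
        u ⁻¹ ^ (length X ℕ.+ length X) * u ⁻¹ ^ length O      ≈⟨ ^-homo-* _ (length X ℕ.+ length X) (length O) ⟨
        u ⁻¹ ^ (length X ℕ.+ length X ℕ.+ length O)           ≈⟨ ^-congʳ _ (≡.trans count′ (≡.cong suc q≡1+nonzeros)) ⟩
        u ⁻¹ * (u ⁻¹ * u ⁻¹ ^ n)                              ≈⟨ *-congˡ (*-congˡ (fermat⁻¹ u≉0)) ⟩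
        u ⁻¹ * (u ⁻¹ * 1#)                                    ≈⟨ *-congˡ (*-identityʳ _) ⟩
        u ⁻¹ * u ⁻¹                                           ∎

      px : I → Carrier
      px z = x z ⁻¹

      -- The scaling factor common to all terms: once it is split off, only slopes remain.
      K : Carrier
      K = ∏ px X * ∏ px X * ∏ px O * (y z₀ ⁻¹ * y z₀ ⁻¹)

      term : I → Carrier
      term a = ∏ (λ z → br z a ⁻¹ * br z a ⁻¹) (z₀ ∷ X) * ∏ (λ o → br o a ⁻¹) O

      y₀≉0 : ∀ {a} → a ∈ M → y z₀ ≉ 0#
      y₀≉0 a∈ e = xy₀≉0 a∈ (trans (*-congˡ e) (zeroʳ _))

      z₀-product : ∀ L → (∀ {a} → a ∈ L → a ∈ M) →
                   ∏ (λ z → br z z₀ ⁻¹) L ≈ ∏ px L * y z₀ ⁻¹ ^ length L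
      z₀-product L L⊆M = begin
        ∏ (λ z → br z z₀ ⁻¹) L      ≈⟨ ∏-cong L (λ z∈ → trans (⁻¹-cong (br-az₀ (L⊆M z∈))) (⁻¹-* (x≉0 (L⊆M z∈)) (y₀≉0 (L⊆M z∈)))) ⟩
        ∏ (λ z → px z * y z₀ ⁻¹) L  ≈⟨ ∏-* _ _ L ⟩
        ∏ px L * ∏ (λ _ → y z₀ ⁻¹) L ≈⟨ *-congˡ (∏-const _ L (λ _ → refl)) ⟩
        ∏ px L * y z₀ ⁻¹ ^ length L  ∎

      -- A bracket with the point at infinity is x z times y z₀ and contains no slope, so nothing
      -- but `K` is left.
      term-z₀ : y z₀ ≉ 0# → term z₀ ≈ K
      term-z₀ y₀≉0 = begin
        br z₀ z₀ ⁻¹ * br z₀ z₀ ⁻¹ * ∏ (λ z → br z z₀ ⁻¹ * br z z₀ ⁻¹) X * ∏ (λ o → br o z₀ ⁻¹) O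
          ≈⟨ *-cong (*-cong (trans (*-cong (0⁻¹ br-z₀z₀) (0⁻¹ br-z₀z₀)) (*-identityˡ 1#))
                            (trans (∏-* _ _ X) (*-cong (z₀-product X X⊆M) (z₀-product X X⊆M))))
                    (z₀-product O O⊆M) ⟩
        1# * ((PX * cX) * (PX * cX)) * (PO * cO)
          ≈⟨ *-congʳ (*-identityˡ _) ⟩
        ((PX * cX) * (PX * cX)) * (PO * cO)
          ≈⟨ solve 4 (λ PX cX PO cO → ((PX ⊕ cX) ⊕ (PX ⊕ cX)) ⊕ (PO ⊕ cO) ⊜ ((PX ⊕ PX) ⊕ PO) ⊕ ((cX ⊕ cX) ⊕ cO)) refl PX cX PO cO ⟩
        PX * PX * PO * (cX * cX * cO)
          ≈⟨ *-congˡ (power y₀≉0) ⟩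
        K ∎
        where
        PX = ∏ px X
        PO = ∏ px O
        cX = y z₀ ⁻¹ ^ length X
        cO = y z₀ ⁻¹ ^ length O

      -- The square supplies two copies of `∏ (δ a) X`. One joins the product over `O` to become - T
      -- a, the other stays as the denominator of Lagrange interpolation. All powers of `x a` cancel
      -- by `power`.
      term-a : ∀ {a} → a ∈ X → term a ≈ (- K) * (T a * ∏ (δ a) X)
      term-a {a} a∈X = begin
        br z₀ a ⁻¹ * br z₀ a ⁻¹ * ∏ (λ z → br z a ⁻¹ * br z a ⁻¹) X * ∏ (λ o → br o a ⁻¹) O
          ≈⟨ *-cong (*-cong head (trans (∏-* _ _ X) (*-cong body body))) tail ⟩
        ((u * e) * (u * e)) * (((v * v) * (PX * (uX * DX))) * ((v * v) * (PX * (uX * DX)))) * (PO * (uO * DO))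
          ≈⟨ solve 9 (λ u v e PX uX DX PO uO DO →
               (((u ⊕ e) ⊕ (u ⊕ e)) ⊕ (((v ⊕ v) ⊕ (PX ⊕ (uX ⊕ DX))) ⊕ ((v ⊕ v) ⊕ (PX ⊕ (uX ⊕ DX))))) ⊕ (PO ⊕ (uO ⊕ DO))
               ⊜ ((((PX ⊕ PX) ⊕ PO) ⊕ (e ⊕ e)) ⊕ ((((v ⊕ u) ⊕ (v ⊕ u)) ⊕ (v ⊕ v)) ⊕ ((uX ⊕ uX) ⊕ uO))) ⊕ ((DX ⊕ DO) ⊕ DX))
               refl u v e PX uX DX PO uO DO ⟩
        K * (((v * u) * (v * u)) * (v * v) * (uX * uX * uO)) * ((DX * DO) * DX)
          ≈⟨ *-cong (*-congˡ units) (*-congʳ (∏δ≈-T (X⊆M a∈X))) ⟩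
        K * 1# * (- T a * DX)         ≈⟨ *-cong (*-identityʳ K) (sym (-‿distribˡ-* _ _)) ⟩
        K * - (T a * DX)              ≈⟨ trans (sym (-‿distribʳ-* _ _)) (-‿distribˡ-* _ _) ⟩
        - K * (T a * DX)              ∎
        where
        a∈ = X⊆M a∈X
        u = x a ⁻¹
        v = x a
        e = y z₀ ⁻¹
        PX = ∏ px X
        PO = ∏ px O
        DX = ∏ (δ a) X
        DO = ∏ (δ a) O
        uX = u ^ length X
        uO = u ^ length O
        vu≈1 : v * u ≈ 1#
        vu≈1 = *-inverseʳ (x≉0 a∈)
        head : br z₀ a ⁻¹ * br z₀ a ⁻¹ ≈ (u * e) * (u * e)
        head = trans (*-cong (⁻¹-cong (br-z₀a a∈)) (⁻¹-cong (br-z₀a a∈)))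
          (trans ([-x]⁻¹² _) (*-cong (⁻¹-* (x≉0 a∈) (y₀≉0 a∈)) (⁻¹-* (x≉0 a∈) (y₀≉0 a∈))))
        factor : ∀ {z} → z ∈ M → z ≢ a → br z a ⁻¹ ≈ px z * (u * δ a z)
        factor z∈ z≢a = trans (⁻¹-cong (br-m z∈ a∈)) (trans (⁻¹-* (x≉0 z∈) (*-≉0 (x≉0 a∈) d≉0)) (*-congˡ (⁻¹-* (x≉0 a∈) d≉0)))
          where d≉0 = x≉y⇒x-y≉0 (m-distinct a∈ z∈ (z≢a ∘ ≡.sym))
        -- The default br a a ⁻¹ = 1 breaks the pattern of `factor`, which would give `u * u`; the
        -- constant `v * v` repairs this.
        self : br a a ⁻¹ ≈ (v * v) * (u * (u * δ a a))
        self = begin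
          br a a ⁻¹                      ≈⟨ 0⁻¹ (trans (br-xy (there a∈) (there a∈)) (-‿inverseʳ _)) ⟩
          1#                             ≈⟨ *-identityˡ 1# ⟨
          1# * 1#                        ≈⟨ *-cong vu≈1 vu≈1 ⟨
          (v * u) * (v * u)              ≈⟨ *-interchange _ _ _ _ ⟩
          (v * v) * (u * u)              ≈⟨ *-congˡ (*-congˡ (trans (*-congˡ (0⁻¹ (-‿inverseʳ _))) (*-identityʳ u))) ⟨
          (v * v) * (u * (u * δ a a))    ∎
        body : ∏ (λ z → br z a ⁻¹) X ≈ (v * v) * (PX * (uX * DX))
        body = trans (∏-update X (proj₁ (unique-++⁻ X uM)) a∈X (factor ∘ X⊆M) self)
          (*-congˡ (∏-scaled px (δ a) u X))
        tail : ∏ (λ o → br o a ⁻¹) O ≈ PO * (uO * DO)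
        tail = trans (∏-cong O (λ o∈ → factor (O⊆M o∈) (unique-++-disjoint uM a∈X o∈ ∘ ≡.sym)))
          (∏-scaled px (δ a) u O)
        units : ((v * u) * (v * u)) * (v * v) * (uX * uX * uO) ≈ 1#
        units = begin
          ((v * u) * (v * u)) * (v * v) * (uX * uX * uO) ≈⟨ *-cong (*-congʳ (trans (*-cong vu≈1 vu≈1) (*-identityˡ 1#))) (power (x≉0 a∈)) ⟩
          1# * (v * v) * (u * u)                         ≈⟨ *-congʳ (*-identityˡ _) ⟩
          (v * v) * (u * u)                              ≈⟨ *-interchange _ _ _ _ ⟩
          (v * u) * (v * u)                              ≈⟨ *-cong vu≈1 vu≈1 ⟩
          1# * 1#                                        ≈⟨ *-identityˡ 1# ⟩
          1#                                             ∎

    -- Infinity contributes `K`, the affine points contribute - K times a divided difference of `T`,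
    -- and that divided difference is the leading coefficient 1.
    planar-sum : ∑ (λ a → ∏ (λ z → br z a ⁻¹ * br z a ⁻¹) (z₀ ∷ X) * ∏ (λ o → br o a ⁻¹) O) (z₀ ∷ X) ≈ 0#
    planar-sum = begin
      term z₀ + ∑ term X                                    ≈⟨ +-cong (term-z₀ (nonempty count-W)) (∑-cong X term-a) ⟩
      K + ∑ (λ a → (- K) * (T a * ∏ (δ a) X)) X             ≈⟨ +-congˡ (*-∑ _ _ X) ⟨
      K + (- K) * dd (map from W) X                         ≈⟨ +-congˡ (*-congˡ (dd-leading (map from W) X (proj₁ (unique-++⁻ X uM))
                                                                (λ a∈ b∈ → m-distinct (X⊆M a∈) (X⊆M b∈))
                                                                (≡.trans count-W (≡.cong suc (≡.sym (length-map from W)))))) ⟩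
      K + (- K) * 1#                                        ≈⟨ +-congˡ (*-identityʳ _) ⟩
      K - K                                                 ≈⟨ -‿inverseʳ K ⟩
      0#                                                    ∎
      where
      first : ∀ L {k} → length L ≡ suc k → ∃ λ a → a ∈ L
      first (a ∷ _) _ = a , here ≡.refl
      nonempty : ∀ {k} → length X ≡ suc k → y z₀ ≉ 0#
      nonempty e = y₀≉0 (X⊆M (proj₂ (first X e)))

-- Inclusion and exclusion between C₀ and C₁.

module InclusionExclusion {c ℓ} (F : Field c ℓ) (q : ℕ) (size : HasSize (Field.setoid F) q) where

  open FiniteField F q size
  open import Relation.Binary.Reasoning.Setoid setoid

  module _ {i} {I : Set i} (C₀ C₁ : List I) (r : ℕ) (β : List I → Carrier)
    (β-↭ : ∀ {C C′} → C ↭ C′ → length C ≡ r → (∀ {a} → a ∈ C → a ∈ C₀ ++ C₁) → β C ≈ β C′)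
    (β-repeated : ∀ {C} → ¬ Uniqueₚ C → β C ≈ 0#)
    (β-sum : ∀ Y → suc (length Y) ≡ r → (∀ {a} → a ∈ Y → a ∈ C₀ ++ C₁) → ∑ (λ a → β (a ∷ Y)) (C₀ ++ C₁) ≈ 0#)
    (|C₀|≡r : length C₀ ≡ r) (|C₁|<r : length C₁ < r)
    (r!≉0 : ∀ j → suc j ≤ r → suc j · 1# ≉ 0#)
    where

    private
      E : List I
      E = C₀ ++ C₁

      -- Sums over ordered tuples instead of subsets: tuples with a repetition contribute 0, and
      -- each j-subset is met j! times, which is where the factorials come from.
      C₁-sum : ℕ → List I → Carrier
      C₁-sum zero    d = β d
      C₁-sum (suc j) d = ∑ (λ a → C₁-sum j (a ∷ d)) C₁

      ∷-⊆ : ∀ {b} {d L : List I} → b ∈ L → (∀ {a} → a ∈ d → a ∈ L) → ∀ {a} → a ∈ b ∷ d → a ∈ L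
      ∷-⊆ b∈ d⊆ (here ≡.refl) = b∈
      ∷-⊆ b∈ d⊆ (there a∈)    = d⊆ a∈

      C₁-sum-↭ : ∀ j {d d′} → d ↭ d′ → j ℕ.+ length d ≡ r → (∀ {a} → a ∈ d → a ∈ E) → C₁-sum j d ≈ C₁-sum j d′
      C₁-sum-↭ zero    p eq d⊆E = β-↭ p eq d⊆E
      C₁-sum-↭ (suc j) p eq d⊆E = ∑-cong C₁ (λ {a} a∈ →
        C₁-sum-↭ j (prep a p) (≡.trans (ℕ.+-suc j _) eq) (∷-⊆ (∈-++⁺ʳ C₀ a∈) d⊆E))

      C₁-sum-repeated : ∀ j {d} → ¬ Uniqueₚ d → C₁-sum j d ≈ 0#
      C₁-sum-repeated zero    ¬u = β-repeated ¬u
      C₁-sum-repeated (suc j) ¬u = ∑-zero C₁ (λ _ → C₁-sum-repeated j (λ { (_ ∷ u) → ¬u u }))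

      -- Interchanging the sums moves one entry from `C₁` into `Y`, until `β-sum` applies to a list
      -- of r - 1 entries.
      C₁-sum-sum : ∀ j Y → suc (j ℕ.+ length Y) ≡ r → (∀ {a} → a ∈ Y → a ∈ E) →
                   ∑ (λ b → C₁-sum j (b ∷ Y)) E ≈ 0#
      C₁-sum-sum zero    Y eq Y⊆E = β-sum Y eq Y⊆E
      C₁-sum-sum (suc j) Y eq Y⊆E = begin
        ∑ (λ b → ∑ (λ a → C₁-sum j (a ∷ b ∷ Y)) C₁) E
          ≈⟨ ∑-cong E (λ {b} b∈ → ∑-cong C₁ (λ {a} a∈ → C₁-sum-↭ j (swap a b ↭-refl)
               (≡.trans (ℕ.+-suc j _) (≡.trans (≡.cong suc (ℕ.+-suc j _)) eq))
               (∷-⊆ (∈-++⁺ʳ C₀ a∈) (∷-⊆ b∈ Y⊆E)))) ⟩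
        ∑ (λ b → ∑ (λ a → C₁-sum j (b ∷ a ∷ Y)) C₁) E
          ≈⟨ ∑-swap _ E C₁ ⟩
        ∑ (λ a → ∑ (λ b → C₁-sum j (b ∷ a ∷ Y)) E) C₁
          ≈⟨ ∑-zero C₁ (λ {a} a∈ → C₁-sum-sum j (a ∷ Y) (≡.trans (≡.cong suc (ℕ.+-suc j _)) eq) (∷-⊆ (∈-++⁺ʳ C₀ a∈) Y⊆E)) ⟩
        0# ∎

      -- (-1)^j j!
      κ : ℕ → Carrier
      κ zero    = 1#
      κ (suc j) = - (suc j · κ j)

      κ≉0 : ∀ j → j ≤ r → κ j ≉ 0#
      κ≉0 zero    _   = 0≉1 ∘ sym
      κ≉0 (suc j) j<r = -≉0 (*-≉0 (r!≉0 j j<r) (κ≉0 j (ℕ.<⇒≤ j<r)) ∘ trans (trans (×-assoc-* (suc j) 1# (κ j)) (×-congʳ (suc j) (*-identityˡ _))))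

      -- Moving the sum from E to C₁ one coordinate at a time.
      C₁-sum-complement : ∀ j e d → C₀ ↭ e ++ d → length e ≡ j → C₁-sum j d ≈ κ j * β C₀
      C₁-sum-complement zero    [] d p _ = trans (sym (β-↭ p |C₀|≡r ∈-++⁺ˡ)) (sym (*-identityˡ _))
      C₁-sum-complement (suc j) e  d p eq = begin
        ∑ g C₁                        ≈⟨ inverseʳ-unique _ _ total ⟩
        - (∑ g e)                     ≈⟨ -‿cong (∑-const (κ j * β C₀) e on-e) ⟩
        - (length e · (κ j * β C₀))   ≈⟨ -‿cong (×-congˡ eq) ⟩
        - (suc j · (κ j * β C₀))      ≈⟨ -‿cong (×-assoc-* (suc j) _ _) ⟨
        - (suc j · κ j * β C₀)        ≈⟨ -‿distribˡ-* _ _ ⟩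
        - (suc j · κ j) * β C₀        ∎
        where
        g : I → Carrier
        g b = C₁-sum j (b ∷ d)
        d⊆C₀ : ∀ {a} → a ∈ d → a ∈ C₀
        d⊆C₀ a∈ = ∈-resp-↭ (↭-sym p) (∈-++⁺ʳ e a∈)
        lengths : suc (j ℕ.+ length d) ≡ r
        lengths = ≡.trans (≡.cong (ℕ._+ length d) (≡.sym eq)) (≡.trans (≡.sym (length-++ e)) (≡.trans (≡.sym (↭-length p)) |C₀|≡r))
        on-d : ∀ {b} → b ∈ d → g b ≈ 0#
        on-d b∈ = C₁-sum-repeated j (λ u → Unique.Unique[x∷xs]⇒x∉xs u b∈)
        on-e : ∀ {b} → b ∈ e → g b ≈ κ j * β C₀
        on-e {b} b∈ = let e′ , e↭ = ∈⇒↭∷ b∈ in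
          C₁-sum-complement j e′ (b ∷ d)
            (↭-trans p (↭-trans (++⁺ʳ d e↭) (↭-sym (shift b e′ d))))
            (ℕ.suc-injective (≡.trans (≡.sym (↭-length e↭)) eq))
        total : ∑ g e + ∑ g C₁ ≈ 0#
        total = begin
          ∑ g e + ∑ g C₁            ≈⟨ +-congʳ (+-identityʳ _) ⟨
          ∑ g e + 0# + ∑ g C₁       ≈⟨ +-congʳ (+-congˡ (∑-zero d on-d)) ⟨
          ∑ g e + ∑ g d + ∑ g C₁    ≈⟨ +-congʳ (∑-++ g e d) ⟨
          ∑ g (e ++ d) + ∑ g C₁     ≈⟨ +-congʳ (∑-↭ g p) ⟨
          ∑ g C₀ + ∑ g C₁           ≈⟨ ∑-++ g C₀ C₁ ⟨
          ∑ g E                     ≈⟨ C₁-sum-sum j d lengths (∈-++⁺ˡ ∘ d⊆C₀) ⟩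
          0#                        ∎

      -- Pigeonhole: r entries taken from fewer than r vectors must repeat.
      C₁-sum-inside : ∀ j d → j ℕ.+ length d ≡ r → (∀ {a} → a ∈ d → a ∈ C₁) → C₁-sum j d ≈ 0#
      C₁-sum-inside zero    d eq d⊆C₁ = β-repeated (λ u → ℕ.<⇒≱ |C₁|<r (≡.subst (_≤ length C₁) eq (unique-⊆⇒length≤ u d⊆C₁)))
      C₁-sum-inside (suc j) d eq d⊆C₁ = ∑-zero C₁ (λ {a} a∈ →
        C₁-sum-inside j (a ∷ d) (≡.trans (ℕ.+-suc j _) eq) (∷-⊆ a∈ d⊆C₁))

    -- The sum over all r-tuples of `C₁` is computed twice: traded against `C₀` it is `κ r * β C₀`,
    -- and by pigeonhole it is 0.
    β-vanishes : β C₀ ≈ 0#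
    β-vanishes = x*y≈0⇒y≈0 (κ≉0 r ℕ.≤-refl) (trans
      (sym (C₁-sum-complement r C₀ [] (↭-reflexive (≡.sym (++-identityʳ C₀))) |C₀|≡r))
      (C₁-sum-inside r [] (ℕ.+-identityʳ r) (λ ())))

-- The exterior algebra of Fᵏ, an element being given by its coefficients at the
-- 2ᵏ products of distinct basis vectors.
module Exterior {c ℓ} (F : Field c ℓ) (q : ℕ) (size : HasSize (Field.setoid F) q) where

  open FiniteField F q size
  open import Relation.Binary.Reasoning.Setoid setoid

  Vector Λ : ℕ → Set c
  Vector k = Fin k → Carrier
  Λ k = Vec Bool k → Carrier

  private variable
    k : ℕ

  infixr 5 _∧_
  -- Split off the first basis vector e: with v = v₀ e + v′ and ω = η + e ∧ θ, the product v ∧ ω is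
  -- v′ ∧ η + e ∧ (v₀ η - v′ ∧ θ). The minus sign comes from moving v′ past e.
  _∧_ : Vector k → Λ k → Λ k
  (v ∧ ω) []          = 0#
  (v ∧ ω) (false ∷ s) = ((v ∘ suc) ∧ (λ t → ω (false ∷ t))) s
  (v ∧ ω) (true ∷ s)  = v zero * ω (false ∷ s) - ((v ∘ suc) ∧ (λ t → ω (true ∷ t))) s

  ∧-cong : ∀ {v w : Vector k} {ω η : Λ k} → (∀ j → v j ≈ w j) → (∀ s → ω s ≈ η s) → ∀ s → (v ∧ ω) s ≈ (w ∧ η) s
  ∧-cong v≈w ω≈η []          = refl
  ∧-cong v≈w ω≈η (false ∷ s) = ∧-cong (v≈w ∘ suc) (λ t → ω≈η (false ∷ t)) s
  ∧-cong v≈w ω≈η (true ∷ s)  = +-cong (*-cong (v≈w zero) (ω≈η _))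
    (-‿cong (∧-cong (v≈w ∘ suc) (λ t → ω≈η (true ∷ t)) s))

  ∧-congʳ : ∀ (v : Vector k) {ω η : Λ k} → (∀ s → ω s ≈ η s) → ∀ s → (v ∧ ω) s ≈ (v ∧ η) s
  ∧-congʳ v = ∧-cong (λ _ → refl)

  x≈0∧y≈0⇒x-y≈0 : ∀ {x y} → x ≈ 0# → y ≈ 0# → x - y ≈ 0#
  x≈0∧y≈0⇒x-y≈0 x≈0 y≈0 = trans (+-cong x≈0 (trans (-‿cong y≈0) -0#≈0#)) (+-identityˡ _)

  ∧-zero : ∀ (v : Vector k) {ω : Λ k} → (∀ s → ω s ≈ 0#) → ∀ s → (v ∧ ω) s ≈ 0#
  ∧-zero v ω≈0 []          = refl
  ∧-zero v ω≈0 (false ∷ s) = ∧-zero (v ∘ suc) (λ t → ω≈0 (false ∷ t)) s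
  ∧-zero v ω≈0 (true ∷ s)  = x≈0∧y≈0⇒x-y≈0 (trans (*-congˡ (ω≈0 _)) (zeroʳ _)) (∧-zero (v ∘ suc) (λ t → ω≈0 (true ∷ t)) s)

  -[x-y]≈-x--y : ∀ x y → - (x - y) ≈ - x - - y
  -[x-y]≈-x--y x y = sym (-‿+-comm x (- y))

  ∧-neg : ∀ (v : Vector k) (ω : Λ k) s → (v ∧ (λ t → - ω t)) s ≈ - (v ∧ ω) s
  ∧-neg v ω []          = sym -0#≈0#
  ∧-neg v ω (false ∷ s) = ∧-neg (v ∘ suc) (λ t → ω (false ∷ t)) s
  ∧-neg v ω (true ∷ s)  = trans
    (+-cong (sym (-‿distribʳ-* _ _)) (-‿cong (∧-neg (v ∘ suc) (λ t → ω (true ∷ t)) s)))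
    (sym (-[x-y]≈-x--y _ _))

  x-y-[z-w]≈x-z-[y-w] : ∀ x y z w → (x - y) - (z - w) ≈ (x - z) - (y - w)
  x-y-[z-w]≈x-z-[y-w] x y z w = begin
    (x - y) + - (z - w)       ≈⟨ +-congˡ (-[x-y]≈-x--y z w) ⟩
    (x - y) + (- z - - w)     ≈⟨ +-interchange _ _ _ _ ⟩
    (x - z) + (- y - - w)     ≈⟨ +-congˡ (-[x-y]≈-x--y y w) ⟨
    (x - z) + - (y - w)       ∎

  -- Linearity in the very shape of the `true` clause of `_∧_`, so that a second vector can be
  -- multiplied through that clause.
  ∧-linear : ∀ (v : Vector k) a (ω η : Λ k) s →
             (v ∧ (λ t → a * ω t - η t)) s ≈ a * (v ∧ ω) s - (v ∧ η) s
  ∧-linear v a ω η []          = sym (x≈0∧y≈0⇒x-y≈0 (zeroʳ a) refl)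
  ∧-linear v a ω η (false ∷ s) = ∧-linear (v ∘ suc) a (λ t → ω (false ∷ t)) (λ t → η (false ∷ t)) s
  ∧-linear v a ω η (true ∷ s)  = begin
    v zero * (a * x - y) - (v′ ∧ (λ t → a * ω (true ∷ t) - η (true ∷ t))) s
      ≈⟨ +-cong (trans (distribˡ _ _ _) (+-cong (x*yz≈y*xz _ _ _) (sym (-‿distribʳ-* _ _)))) (-‿cong (∧-linear v′ a _ _ s)) ⟩
    (a * (v zero * x) - v zero * y) - (a * z - w)
      ≈⟨ x-y-[z-w]≈x-z-[y-w] _ _ _ _ ⟩
    (a * (v zero * x) - a * z) - (v zero * y - w)
      ≈⟨ +-congʳ (trans (distribˡ _ _ _) (+-congˡ (sym (-‿distribʳ-* _ _)))) ⟨
    a * (v zero * x - z) - (v zero * y - w) ∎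
    where
    v′ = v ∘ suc
    x = ω (false ∷ s)
    y = η (false ∷ s)
    z = (v′ ∧ (λ t → ω (true ∷ t))) s
    w = (v′ ∧ (λ t → η (true ∷ t))) s

  x-[y-z]≈x-y+z : ∀ x y z → x - (y - z) ≈ (x - y) + z
  x-[y-z]≈x-y+z x y z = trans (+-congˡ (trans (-[x-y]≈-x--y y z) (+-congˡ (-‿involutive z)))) (sym (+-assoc _ _ _))

  -- Has its own proof because in characteristic 2 it does not follow from `∧-anticommute`.
  ∧-self : ∀ (v : Vector k) (ω : Λ k) s → (v ∧ v ∧ ω) s ≈ 0#
  ∧-self v ω []          = refl
  ∧-self v ω (false ∷ s) = ∧-self (v ∘ suc) (λ t → ω (false ∷ t)) s
  ∧-self v ω (true ∷ s)  = begin
    v zero * z - (v′ ∧ (v ∧ ω) ∘ (true ∷_)) s ≈⟨ +-congˡ (-‿cong (∧-linear v′ (v zero) _ _ s)) ⟩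
    v zero * z - (v zero * z - w)             ≈⟨ x-[y-z]≈x-y+z _ _ _ ⟩
    (v zero * z - v zero * z) + w             ≈⟨ +-cong (-‿inverseʳ _) (∧-self v′ (λ t → ω (true ∷ t)) s) ⟩
    0# + 0#                                   ≈⟨ +-identityˡ 0# ⟩
    0#                                        ∎
    where
    v′ = v ∘ suc
    z = (v′ ∧ (λ t → ω (false ∷ t))) s
    w = (v′ ∧ v′ ∧ (λ t → ω (true ∷ t))) s

  ∧-anticommute : ∀ (v w : Vector k) (ω : Λ k) s → (v ∧ w ∧ ω) s ≈ - (w ∧ v ∧ ω) s
  ∧-anticommute v w ω []          = sym -0#≈0#
  ∧-anticommute v w ω (false ∷ s) = ∧-anticommute (v ∘ suc) (w ∘ suc) (λ t → ω (false ∷ t)) s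
  ∧-anticommute v w ω (true ∷ s)  = begin
    v zero * w∧x - (v′ ∧ (w ∧ ω) ∘ (true ∷_)) s       ≈⟨ +-congˡ (-‿cong (∧-linear v′ (w zero) _ _ s)) ⟩
    v zero * w∧x - (w zero * v∧x - vwy)               ≈⟨ +-congˡ (-‿cong (+-congˡ (-‿cong (∧-anticommute v′ w′ _ s)))) ⟩
    v zero * w∧x - (w zero * v∧x - - wvy)             ≈⟨ +-congˡ (-‿cong (+-congˡ (-‿involutive wvy))) ⟩
    v zero * w∧x - (w zero * v∧x + wvy)               ≈⟨ -[x-y]≈y-x _ _ ⟨
    - (w zero * v∧x + wvy - v zero * w∧x)             ≈⟨ -‿cong (+-assoc _ _ _) ⟩
    - (w zero * v∧x + (wvy - v zero * w∧x))           ≈⟨ -‿cong (+-congˡ (-[x-y]≈y-x _ _)) ⟨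
    - (w zero * v∧x - (v zero * w∧x - wvy))           ≈⟨ -‿cong (+-congˡ (-‿cong (∧-linear w′ (v zero) _ _ s))) ⟨
    - (w zero * v∧x - (w′ ∧ (v ∧ ω) ∘ (true ∷_)) s)   ∎
    where
    v′ = v ∘ suc
    w′ = w ∘ suc
    w∧x = (w′ ∧ (λ t → ω (false ∷ t))) s
    v∧x = (v′ ∧ (λ t → ω (false ∷ t))) s
    vwy = (v′ ∧ w′ ∧ (λ t → ω (true ∷ t))) s
    wvy = (w′ ∧ v′ ∧ (λ t → ω (true ∷ t))) s

  ∧-∑ : ∀ {i} {I : Set i} (a : I → Carrier) (v : I → Vector k) (ω : Λ k) L s →
        ((λ j → ∑ (λ i → a i * v i j) L) ∧ ω) s ≈ ∑ (λ i → a i * (v i ∧ ω) s) L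
  ∧-∑ a v ω L []          = sym (∑-zero L (λ _ → zeroʳ _))
  ∧-∑ a v ω L (false ∷ s) = ∧-∑ a (λ i → v i ∘ suc) (λ t → ω (false ∷ t)) L s
  ∧-∑ a v ω L (true ∷ s)  = begin
    ∑ (λ i → a i * v i zero) L * x - ((λ j → ∑ (λ i → a i * v i (suc j)) L) ∧ ω ∘ (true ∷_)) s
      ≈⟨ +-cong (trans (*-comm _ _) (*-∑ x _ L)) (trans (-‿cong (∧-∑ a (λ i → v i ∘ suc) _ L s)) (neg-∑ L)) ⟩
    ∑ (λ i → x * (a i * v i zero)) L + ∑ (λ i → - (a i * y i)) L
      ≈⟨ ∑-+ _ _ L ⟨
    ∑ (λ i → x * (a i * v i zero) - a i * y i) L
      ≈⟨ ∑-cong L (λ _ → trans (+-cong (trans (x*yz≈y*xz _ _ _) (*-congˡ (*-comm _ _))) (-‿distribʳ-* _ _)) (sym (distribˡ _ _ _))) ⟩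
    ∑ (λ i → a i * (v i zero * x - y i)) L ∎
    where
    x = ω (false ∷ s)
    y = λ i → ((v i ∘ suc) ∧ (λ t → ω (true ∷ t))) s
    neg-∑ : ∀ L → - ∑ (λ i → a i * y i) L ≈ ∑ (λ i → - (a i * y i)) L
    neg-∑ []      = -0#≈0#
    neg-∑ (i ∷ L) = trans (sym (-‿+-comm _ _)) (+-congˡ (neg-∑ L))

  unit : Λ k
  unit []          = 1#
  unit (false ∷ s) = unit s
  unit (true ∷ s)  = 0#

  ⋀ : List (Vector k) → Λ k
  ⋀ []       = unit
  ⋀ (v ∷ vs) = v ∧ ⋀ vs

  infix 4 _≈±_
  -- A single sign serves all coefficients. Which sign a permutation has is never computed.
  _≈±_ : Λ k → Λ k → Set ℓ
  ω ≈± η = (∀ s → ω s ≈ η s) ⊎ (∀ s → ω s ≈ - η s)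

  ∧-≈± : ∀ (v : Vector k) {ω η : Λ k} → ω ≈± η → (v ∧ ω) ≈± (v ∧ η)
  ∧-≈± v (inj₁ e) = inj₁ (∧-congʳ v e)
  ∧-≈± v (inj₂ e) = inj₂ (λ s → trans (∧-congʳ v e s) (∧-neg v _ s))

  ≈±-trans : ∀ {ω η θ : Λ k} → ω ≈± η → η ≈± θ → ω ≈± θ
  ≈±-trans (inj₁ e) (inj₁ f) = inj₁ (λ s → trans (e s) (f s))
  ≈±-trans (inj₁ e) (inj₂ f) = inj₂ (λ s → trans (e s) (f s))
  ≈±-trans (inj₂ e) (inj₁ f) = inj₂ (λ s → trans (e s) (-‿cong (f s)))
  ≈±-trans (inj₂ e) (inj₂ f) = inj₁ (λ s → trans (e s) (trans (-‿cong (f s)) (-‿involutive _)))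

  ⋀-↭ : ∀ {vs ws : List (Vector k)} → vs ↭ ws → ⋀ vs ≈± ⋀ ws
  ⋀-↭ _↭_.refl        = inj₁ (λ _ → refl)
  ⋀-↭ (prep v p)      = ∧-≈± v (⋀-↭ p)
  ⋀-↭ {vs = _ ∷ _ ∷ vs} (swap v w p) =
    ≈±-trans (inj₂ (∧-anticommute v w (⋀ vs))) (∧-≈± w (∧-≈± v (⋀-↭ p)))
  ⋀-↭ (_↭_.trans p p′) = ≈±-trans (⋀-↭ p) (⋀-↭ p′)

  ≈±-zero : ∀ {ω η : Λ k} {s} → ω ≈± η → η s ≈ 0# → ω s ≈ 0#
  ≈±-zero {s = s} (inj₁ e) η≈0 = trans (e s) η≈0
  ≈±-zero {s = s} (inj₂ e) η≈0 = trans (e s) (trans (-‿cong η≈0) -0#≈0#)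

  -- The coefficient here of a product of k vectors is their determinant.
  top : Vec Bool k
  top = Vec.replicate _ true

  lift : Vector k → Vector (suc k)
  lift v zero    = 0#
  lift v (suc j) = v j

  e₀ : Vector (suc k)
  e₀ zero    = 1#
  e₀ (suc j) = 0#

  standardBasis : ∀ k → List (Vector k)
  standardBasis zero    = []
  standardBasis (suc k) = e₀ ∷ map lift (standardBasis k)

  length-standardBasis : ∀ k → length (standardBasis k) ≡ k
  length-standardBasis zero    = ≡.refl
  length-standardBasis (suc k) = ≡.cong suc (≡.trans (length-map lift (standardBasis k)) (length-standardBasis k))

  ⋀-lift-true : ∀ (vs : List (Vector k)) s → ⋀ (map lift vs) (true ∷ s) ≈ 0#
  ⋀-lift-true []       s = refl
  ⋀-lift-true (v ∷ vs) s = x≈0∧y≈0⇒x-y≈0 (zeroˡ _) (∧-zero v (⋀-lift-true vs) s)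

  ⋀-lift-false : ∀ (vs : List (Vector k)) s → ⋀ (map lift vs) (false ∷ s) ≈ ⋀ vs s
  ⋀-lift-false []       s = refl
  ⋀-lift-false (v ∷ vs) s = ∧-congʳ v (⋀-lift-false vs) s

  ⋀-standardBasis : ∀ k → ⋀ (standardBasis k) top ≈ 1#
  ⋀-standardBasis zero    = refl
  ⋀-standardBasis (suc k) = begin
    1# * ⋀ (map lift B) (false ∷ top) - ((λ _ → 0#) ∧ (λ t → ⋀ (map lift B) (true ∷ t))) top
      ≈⟨ +-cong (trans (*-identityˡ _) (trans (⋀-lift-false B top) (⋀-standardBasis k)))
                (trans (-‿cong (∧-zero (λ _ → 0#) (⋀-lift-true B) top)) -0#≈0#) ⟩
    1# + 0# ≈⟨ +-identityʳ 1# ⟩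
    1#      ∎
    where B = standardBasis k

  -- Brackets: determinants of indexed families of vectors.

  module Bracket {i} {I : Set i} (_≟_ : DecidableEquality I) {k} (v : I → Vector k) where

    bracket : List I → Carrier
    bracket J = ⋀ (map v J) top

    -- The sign is uniform in z, so over a product of such brackets it accumulates to a power of -1.
    bracket-∷-↭ : ∀ {J J′} → J ↭ J′ →
      (∀ z → bracket (z ∷ J) ≈ bracket (z ∷ J′)) ⊎ (∀ z → bracket (z ∷ J) ≈ - bracket (z ∷ J′))
    bracket-∷-↭ p with ⋀-↭ (map⁺ v p)
    ... | inj₁ e = inj₁ (λ z → ∧-congʳ (v z) e top)
    ... | inj₂ e = inj₂ (λ z → trans (∧-congʳ (v z) e top) (∧-neg (v z) _ top))

    bracket-swap : ∀ a b J → bracket (a ∷ b ∷ J) ≈ - bracket (b ∷ a ∷ J)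
    bracket-swap a b J = ∧-anticommute (v a) (v b) (⋀ (map v J)) top

    bracket-repeated : ∀ {J} → ¬ Uniqueₚ J → bracket J ≈ 0#
    bracket-repeated {J} ¬u with a , ys , p ← ¬unique⇒↭∷∷ _≟_ J ¬u =
      ≈±-zero (⋀-↭ (map⁺ v p)) (∧-self (v a) (⋀ (map v ys)) top)

    Spanning : List I → Set (i ⊔ c ⊔ ℓ)
    Spanning L = ∀ (w : Vector k) → ∃ λ (a : I → Carrier) → ∀ j → w j ≈ ∑ (λ i → a i * v i j) L

    -- The coefficients are chosen before `J`, so that one expansion of `v b` can be used in several
    -- brackets.
    bracket-expand : ∀ {L} → Spanning L → ∀ b → ∃ λ (a : I → Carrier) → ∀ J → bracket (b ∷ J) ≈ ∑ (λ i → a i * bracket (i ∷ J)) L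
    bracket-expand {L} spans b = let a , e = spans (v b) in
      a , λ J → trans (∧-cong {η = ⋀ (map v J)} e (λ _ → refl) top) (∧-∑ a v (⋀ (map v J)) L top)

    -- If the bracket of a spanning list vanishes, so does every k-fold product:
    -- replace vectors by their expansions one at a time.
    bracket≉0 : ∀ {L} → Uniqueₚ L → length L ≡ k → Spanning L → bracket L ≉ 0#
    bracket≉0 {L} u |L|≡k spans L≈0 = 0≉1 (begin
      0#                                   ≈⟨ vanish (standardBasis k) [] (λ ()) (≡.trans (ℕ.+-identityʳ _) (length-standardBasis k)) ⟨
      ⋀ (standardBasis k ++ []) top        ≡⟨ ≡.cong (λ vs → ⋀ vs top) (++-identityʳ (standardBasis k)) ⟩
      ⋀ (standardBasis k) top              ≈⟨ ⋀-standardBasis k ⟩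
      1#                                   ∎)
      where
      vanish : ∀ ws J → (∀ {a} → a ∈ J → a ∈ L) → length ws ℕ.+ length J ≡ k → ⋀ (ws ++ map v J) top ≈ 0#
      vanish [] J J⊆L eq with unique? _≟_ J
      ... | no ¬u = bracket-repeated ¬u
      ... | yes u = ≈±-zero (⋀-↭ (map⁺ v (↭-sym (unique-⊆-length⇒↭ u J⊆L (≡.trans eq (≡.sym |L|≡k)))))) L≈0
      vanish (w ∷ ws) J J⊆L eq with a , e ← spans w = begin
        (w ∧ ⋀ (ws ++ map v J)) top                         ≈⟨ ∧-cong {η = ⋀ (ws ++ map v J)} e (λ _ → refl) top ⟩
        ((λ j → ∑ (λ i → a i * v i j) L) ∧ ⋀ (ws ++ map v J)) top ≈⟨ ∧-∑ a v (⋀ (ws ++ map v J)) L top ⟩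
        ∑ (λ i → a i * (v i ∧ ⋀ (ws ++ map v J)) top) L     ≈⟨ ∑-zero L (λ i∈ → trans (*-congˡ (moved i∈)) (zeroʳ _)) ⟩
        0#                                                  ∎
        where
        moved : ∀ {i} → i ∈ L → (v i ∧ ⋀ (ws ++ map v J)) top ≈ 0#
        moved {i} i∈ = ≈±-zero (⋀-↭ (↭-sym (shift (v i) ws (map v J))))
          (vanish ws (i ∷ J) (λ { (here ≡.refl) → i∈ ; (there a∈) → J⊆L a∈ }) (≡.trans (ℕ.+-suc _ _) eq))

-- Weights of an arc, and the contradiction when E fits into it.

module ArcBound {c ℓ} (F : Field c ℓ) (q : ℕ) (size : HasSize (Field.setoid F) q) (1<q : 1 < q)
  {p h} (p-prime : Prime p) (q≡p^h : q ≡ p ℕ.^ h) where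

  open FiniteField F q size
  open Exterior F q size
  open Planar F q size 1<q using (planar-sum; [-x]⁻¹²)
  open InclusionExclusion F q size using (β-vanishes)
  open import Relation.Binary.Reasoning.Setoid setoid

  module Brackets {i} {I : Set i} (_≟_ : DecidableEquality I) (t : ℕ) (v : I → Vector (2 ℕ.+ t))
    (spanning : ∀ L → Uniqueₚ L → length L ≡ 2 ℕ.+ t → Bracket.Spanning _≟_ v L)
    (E O : List I) (unique : Uniqueₚ (E ++ O))
    (|E| : length E ≡ suc t ℕ.+ t) (count : suc t ℕ.+ suc t ℕ.+ length O ≡ q ℕ.+ 3)
    where

    open Bracket _≟_ v

    -- For z in `C` the bracket repeats a vector and vanishes; since 0⁻¹ = 1, the first product may
    -- nevertheless run over all of `E`.
    weight : List I → Carrier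
    weight C = ∏ (λ z → bracket (z ∷ C) ⁻¹ * bracket (z ∷ C) ⁻¹) E * ∏ (λ o → bracket (o ∷ C) ⁻¹) O

    weight≉0 : ∀ C → weight C ≉ 0#
    weight≉0 C = *-≉0 (∏-≉0 E (λ _ → *-≉0 (⁻¹≉0 _) (⁻¹≉0 _))) (∏-≉0 O (λ _ → ⁻¹≉0 _))

    -- Extended by 0 to lists with repetitions. On these `weight` would be 1, because all brackets
    -- in it vanish.
    β : List I → Carrier
    β C with unique? _≟_ C
    ... | yes _ = weight C
    ... | no  _ = 0#

    β-unique : ∀ {C} → Uniqueₚ C → β C ≈ weight C
    β-unique {C} u with unique? _≟_ C
    ... | yes _ = refl
    ... | no ¬u = contradiction u ¬u

    β-repeated : ∀ {C} → ¬ Uniqueₚ C → β C ≈ 0#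
    β-repeated {C} ¬u with unique? _≟_ C
    ... | yes u = contradiction u ¬u
    ... | no _  = refl

    -1^even : ∀ j → (- 1#) ^ (j ℕ.+ j) ≈ 1#
    -1^even zero    = refl
    -1^even (suc j) = begin
      - 1# * (- 1#) ^ (j ℕ.+ suc j)       ≈⟨ *-congˡ (^-congʳ (- 1#) (ℕ.+-suc j j)) ⟩
      - 1# * (- 1# * (- 1#) ^ (j ℕ.+ j))  ≈⟨ *-assoc _ _ _ ⟨
      - 1# * - 1# * (- 1#) ^ (j ℕ.+ j)    ≈⟨ *-cong (trans (-x*-y≈x*y 1# 1#) (*-identityˡ 1#)) (-1^even j) ⟩
      1# * 1#                             ≈⟨ *-identityˡ 1# ⟩
      1#                                  ∎

    -- By `count`, |O| has the parity of q - 1, and Fermat for -1 covers odd and even q alike.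
    -1^|O|≈1 : (- 1#) ^ length O ≈ 1#
    -1^|O|≈1 = begin
      (- 1#) ^ length O                                      ≈⟨ *-identityˡ _ ⟨
      1# * (- 1#) ^ length O                                 ≈⟨ *-congʳ (-1^even (suc t)) ⟨
      (- 1#) ^ (suc t ℕ.+ suc t) * (- 1#) ^ length O         ≈⟨ ^-homo-* (- 1#) (suc t ℕ.+ suc t) (length O) ⟨
      (- 1#) ^ (suc t ℕ.+ suc t ℕ.+ length O)                ≈⟨ ^-congʳ (- 1#) (≡.trans count (≡.trans (ℕ.+-comm q 3) (≡.cong (3 ℕ.+_) q≡1+nonzeros))) ⟩
      (- 1#) ^ (4 ℕ.+ length nonzeros)                       ≈⟨ ^-homo-* (- 1#) 4 (length nonzeros) ⟩
      (- 1#) ^ 4 * (- 1#) ^ length nonzeros                  ≈⟨ *-cong (-1^even 2) (fermat (-≉0 (0≉1 ∘ sym))) ⟩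
      1# * 1#                                                ≈⟨ *-identityˡ 1# ⟩
      1#                                                     ∎

    -- All brackets change by one common sign: the squares absorb it over `E`, the parity of |O|
    -- over `O`.
    weight-↭ : ∀ {C C′} → C ↭ C′ → Uniqueₚ C′ → length C′ ≡ suc t → (∀ {a} → a ∈ C′ → a ∈ E) → weight C ≈ weight C′
    weight-↭ {C} {C′} p u eq C′⊆E with bracket-∷-↭ p
    ... | inj₁ e = *-cong
      (∏-cong E (λ {z} _ → *-cong (⁻¹-cong (e z)) (⁻¹-cong (e z))))
      (∏-cong O (λ {o} _ → ⁻¹-cong (e o)))
    ... | inj₂ e = *-cong
      (∏-cong E (λ {z} _ → trans (*-cong (⁻¹-cong (e z)) (⁻¹-cong (e z))) ([-x]⁻¹² _)))
      (begin
        ∏ (λ o → bracket (o ∷ C) ⁻¹) O                  ≈⟨ ∏-cong O (λ o∈ → flip o∈) ⟩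
        ∏ (λ o → - 1# * bracket (o ∷ C′) ⁻¹) O          ≈⟨ ∏-* _ _ O ⟩
        ∏ (λ _ → - 1#) O * ∏ (λ o → bracket (o ∷ C′) ⁻¹) O ≈⟨ *-congʳ (trans (∏-const (- 1#) O (λ _ → refl)) -1^|O|≈1) ⟩
        1# * ∏ (λ o → bracket (o ∷ C′) ⁻¹) O            ≈⟨ *-identityˡ _ ⟩
        ∏ (λ o → bracket (o ∷ C′) ⁻¹) O                 ∎)
      where
      -- The sign can leave the inverse only if the bracket is nonzero. It is: `o` lies outside `E`,
      -- so o ∷ C′ is a list of k distinct vectors of the arc.
      flip : ∀ {o} → o ∈ O → bracket (o ∷ C) ⁻¹ ≈ - 1# * bracket (o ∷ C′) ⁻¹
      flip {o} o∈ = begin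
        bracket (o ∷ C) ⁻¹           ≈⟨ ⁻¹-cong (e o) ⟩
        (- bracket (o ∷ C′)) ⁻¹      ≈⟨ ⁻¹-neg (bracket≉0 u′ (≡.cong suc eq) (spanning (o ∷ C′) u′ (≡.cong suc eq))) ⟩
        - (bracket (o ∷ C′) ⁻¹)      ≈⟨ -‿cong (*-identityˡ _) ⟨
        - (1# * bracket (o ∷ C′) ⁻¹) ≈⟨ -‿distribˡ-* _ _ ⟩
        - 1# * bracket (o ∷ C′) ⁻¹   ∎
        where
        u′ : Uniqueₚ (o ∷ C′)
        u′ = All.tabulate (λ a∈ → unique-++-disjoint unique (C′⊆E a∈) o∈ ∘ ≡.sym) ∷ u

    β-↭ : ∀ {C C′} → C ↭ C′ → length C ≡ suc t → (∀ {a} → a ∈ C → a ∈ E) → β C ≈ β C′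
    β-↭ {C} {C′} p eq C⊆E with unique? _≟_ C | unique? _≟_ C′
    ... | yes u | yes u′ = weight-↭ p u′ (≡.trans (≡.sym (↭-length p)) eq) (C⊆E ∘ ∈-resp-↭ (↭-sym p))
    ... | no _  | no _   = refl
    ... | yes u | no ¬u′ = contradiction (Unique-resp-↭ p u) ¬u′
    ... | no ¬u | yes u′ = contradiction (Unique-resp-↭ (↭-sym p) u′) ¬u

    module Coordinates (Y : List I) (|Y|≡t : length Y ≡ t) (z₀ : I) (X : List I)
      (uYXO : Uniqueₚ (Y ++ z₀ ∷ X ++ O)) (b : I) (b∈ : b ∈ X ++ O) where

      br : I → I → Carrier
      br a d = bracket (a ∷ d ∷ Y)

      unique-a∷b∷Y : ∀ {a b} → a ∈ z₀ ∷ X ++ O → b ∈ z₀ ∷ X ++ O → a ≢ b → Uniqueₚ (a ∷ b ∷ Y)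
      unique-a∷b∷Y a∈ b∈ a≢b =
        (a≢b ∷ All.tabulate (λ y∈ → unique-++-disjoint uYXO y∈ a∈ ∘ ≡.sym)) ∷
        (All.tabulate (λ y∈ → unique-++-disjoint uYXO y∈ b∈ ∘ ≡.sym) ∷
         proj₁ (unique-++⁻ Y uYXO))

      br≉0 : ∀ {a b} → a ∈ z₀ ∷ X ++ O → b ∈ z₀ ∷ X ++ O → a ≢ b → br a b ≉ 0#
      br≉0 a∈ b∈ a≢b = bracket≉0 u eq (spanning _ u eq)
        where
        u = unique-a∷b∷Y a∈ b∈ a≢b
        eq = ≡.cong (2 ℕ.+_) |Y|≡t

      br-self : ∀ a → br a a ≈ 0#
      br-self a = bracket-repeated {a ∷ a ∷ Y} (λ u → Unique.Unique[x∷xs]⇒x∉xs u (here ≡.refl))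

      br-Y : ∀ {y} d → y ∈ Y → br y d ≈ 0#
      br-Y d y∈ = bracket-repeated (λ u → Unique.Unique[x∷xs]⇒x∉xs u (there y∈))

      z₀≢b : b ≢ z₀
      z₀≢b = unique-++-disjoint {xs = z₀ ∷ []} (proj₂ (unique-++⁻ Y uYXO)) (here ≡.refl) b∈ ∘ ≡.sym

      expand : ∀ d → ∃ λ (a : I → Carrier) → ∀ J → bracket (d ∷ J) ≈ ∑ (λ i → a i * bracket (i ∷ J)) (b ∷ z₀ ∷ Y)
      expand = bracket-expand {b ∷ z₀ ∷ Y} (spanning (b ∷ z₀ ∷ Y) (unique-a∷b∷Y (there b∈) (here ≡.refl) z₀≢b) (≡.cong (2 ℕ.+_) |Y|≡t))

      coefficient : I → I → Carrier
      coefficient d = proj₁ (expand d)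

      B : Carrier
      B = br b z₀

      -- Coordinates modulo the span of `Y` in the basis `b`, `z₀`. The factor `B`, the bracket of
      -- that basis, is put into `y` so that `br` becomes the plain 2 by 2 determinant.
      x y : I → Carrier
      x d = coefficient d b
      y d = coefficient d z₀ * B

      br-expand : ∀ a d → br a d ≈ x a * br b d + coefficient a z₀ * br z₀ d
      br-expand a d = trans (proj₂ (expand a) (d ∷ Y)) (+-congˡ (trans
        (+-congˡ (∑-zero Y (λ y∈ → trans (*-congˡ (br-Y d y∈)) (zeroʳ _)))) (+-identityʳ _)))

      br-b : ∀ d → br b d ≈ y d
      br-b d = begin
        br b d                                              ≈⟨ bracket-swap b d Y ⟩
        - br d b                                            ≈⟨ -‿cong (br-expand d b) ⟩
        - (x d * br b b + coefficient d z₀ * br z₀ b)       ≈⟨ -‿cong (+-cong (trans (*-congˡ (br-self b)) (zeroʳ _)) (*-congˡ (bracket-swap z₀ b Y))) ⟩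
        - (0# + coefficient d z₀ * - B)                     ≈⟨ -‿cong (trans (+-identityˡ _) (sym (-‿distribʳ-* _ _))) ⟩
        - - (coefficient d z₀ * B)                          ≈⟨ -‿involutive _ ⟩
        y d                                                 ∎

      br-z₀ : ∀ d → br d z₀ ≈ x d * B
      br-z₀ d = trans (br-expand d z₀) (trans (+-congˡ (trans (*-congˡ (br-self z₀)) (zeroʳ _))) (+-identityʳ _))

      br-xy : ∀ a d → br a d ≈ x a * y d - x d * y a
      br-xy a d = begin
        br a d                                     ≈⟨ br-expand a d ⟩
        x a * br b d + coefficient a z₀ * br z₀ d  ≈⟨ +-cong (*-congˡ (br-b d)) (*-congˡ (trans (bracket-swap z₀ d Y) (-‿cong (br-z₀ d)))) ⟩
        x a * y d + coefficient a z₀ * - (x d * B) ≈⟨ +-congˡ (-‿distribʳ-* _ _) ⟨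
        x a * y d - coefficient a z₀ * (x d * B)   ≈⟨ +-congˡ (-‿cong (x*yz≈y*xz _ _ _)) ⟩
        x a * y d - x d * y a                      ∎

      x-z₀ : x z₀ ≈ 0#
      x-z₀ = x*y≈0⇒y≈0 (br≉0 (there b∈) (here ≡.refl) z₀≢b)
        (trans (*-comm _ _) (trans (sym (br-z₀ z₀)) (br-self z₀)))

    -- The terms with a in `Y` repeat a vector and vanish. In the others the factors at `Y` are the
    -- default 1, so what remains is the planar sum over E minus Y.
    β-sum-unique : ∀ {Y} → Uniqueₚ Y → length Y ≡ t → (∀ {a} → a ∈ Y → a ∈ E) → ∑ (λ a → β (a ∷ Y)) E ≈ 0#
    β-sum-unique {Y} uY |Y|≡t Y⊆E with X , E↭YX ← unique-⊆⇒↭++ uY Y⊆E = begin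
      ∑ (λ a → β (a ∷ Y)) E                            ≈⟨ ∑-↭ _ E↭YX ⟩
      ∑ (λ a → β (a ∷ Y)) (Y ++ X)                     ≈⟨ ∑-++ _ Y X ⟩
      ∑ (λ a → β (a ∷ Y)) Y + ∑ (λ a → β (a ∷ Y)) X    ≈⟨ +-cong (∑-zero Y (λ a∈ → β-repeated (λ u → Unique.Unique[x∷xs]⇒x∉xs u a∈)))
                                                            (∑-cong X (λ a∈ → trans (β-unique (u-a∷Y a∈)) (*-congʳ drop-Y))) ⟩
      0# + ∑ planar X                                  ≈⟨ +-identityˡ _ ⟩
      ∑ planar X                                       ≈⟨ nonempty X |X| uYXO ⟩
      0#                                               ∎
      where
      |X| : length X ≡ suc t
      |X| = ℕ.+-cancelˡ-≡ t _ _ (≡.trans (≡.cong (ℕ._+ length X) (≡.sym |Y|≡t)) (≡.trans (≡.sym (length-++ Y))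
              (≡.trans (≡.sym (↭-length E↭YX)) (≡.trans |E| (ℕ.+-comm (suc t) t)))))
      uYXO : Uniqueₚ (Y ++ X ++ O)
      uYXO = ≡.subst Uniqueₚ (++-assoc Y X O) (Unique-resp-↭ (++⁺ʳ O E↭YX) unique)
      u-a∷Y : ∀ {a} → a ∈ X → Uniqueₚ (a ∷ Y)
      u-a∷Y a∈ = All.tabulate (λ y∈ → unique-++-disjoint uYXO y∈ (∈-++⁺ˡ a∈) ∘ ≡.sym) ∷ uY
      square : I → I → Carrier
      square a z = bracket (z ∷ a ∷ Y) ⁻¹ * bracket (z ∷ a ∷ Y) ⁻¹
      drop-Y : ∀ {a} → ∏ (square a) E ≈ ∏ (square a) X
      drop-Y {a} = begin
        ∏ (square a) E                  ≈⟨ ∏-↭ _ E↭YX ⟩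
        ∏ (square a) (Y ++ X)           ≈⟨ ∏-++ _ Y X ⟩
        ∏ (square a) Y * ∏ (square a) X ≈⟨ *-congʳ (∏-one Y (λ y∈ → trans (*-cong (one y∈) (one y∈)) (*-identityˡ 1#))) ⟩
        1# * ∏ (square a) X             ≈⟨ *-identityˡ _ ⟩
        ∏ (square a) X                  ∎
        where
        one : ∀ {y} → y ∈ Y → bracket (y ∷ a ∷ Y) ⁻¹ ≈ 1#
        one y∈ = 0⁻¹ (bracket-repeated (λ u → Unique.Unique[x∷xs]⇒x∉xs u (there y∈)))
      planar : I → Carrier
      planar a = ∏ (square a) X * ∏ (λ o → bracket (o ∷ a ∷ Y) ⁻¹) O
      -- A further point is wanted to complete `z₀` to a basis of the plane. It may have to come
      -- from `O`; since q + 3 exceeds 2, `X′` and `O′` are not both empty.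
      second : ∀ X′ O′ → suc (length X′) ℕ.+ suc (length X′) ℕ.+ length O′ ≡ q ℕ.+ 3 → ∃ λ b → b ∈ X′ ++ O′
      second (b ∷ _) _       _ = b , here ≡.refl
      second []      (b ∷ _) _ = b , here ≡.refl
      second []      []      e = contradiction (≡.trans e (ℕ.+-comm q 3)) λ ()
      nonempty : ∀ X → length X ≡ suc t → Uniqueₚ (Y ++ X ++ O) →
                 ∑ (λ a → ∏ (square a) X * ∏ (λ o → bracket (o ∷ a ∷ Y) ⁻¹) O) X ≈ 0#
      nonempty (z₀ ∷ X) |X| u with b , b∈ ← second X O (≡.trans (≡.cong (λ m → m ℕ.+ m ℕ.+ length O) |X|) count) =
        planar-sum br x y z₀ X O (proj₂ (unique-++⁻ Y u)) (λ _ _ → br-xy _ _) br≉0 x-z₀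
          (≡.trans (≡.cong (λ m → m ℕ.+ m ℕ.+ length O) |X|) count)
        where open Coordinates Y |Y|≡t z₀ X u b b∈

    β-sum : ∀ Y → suc (length Y) ≡ suc t → (∀ {a} → a ∈ Y → a ∈ E) → ∑ (λ a → β (a ∷ Y)) E ≈ 0#
    β-sum Y eq Y⊆E = by-cases (unique? _≟_ Y)
      where
      by-cases : Dec (Uniqueₚ Y) → ∑ (λ a → β (a ∷ Y)) E ≈ 0#
      by-cases (yes u) = β-sum-unique u (ℕ.suc-injective eq) Y⊆E
      by-cases (no ¬u) = ∑-zero E (λ {a} _ → β-repeated {a ∷ Y} (λ { (_ ∷ u) → ¬u u }))

  short-arc : ∀ {i} {I : Set i} (_≟_ : DecidableEquality I) t (v : I → Vector (2 ℕ.+ t)) →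
    (∀ L → Uniqueₚ L → length L ≡ 2 ℕ.+ t → Bracket.Spanning _≟_ v L) →
    (S : List I) → Uniqueₚ S → length S ≡ 2 ℕ.+ q →
    2 ℕ.+ t ≤ p → suc t ℕ.+ t ≤ 2 ℕ.+ q → ⊥
  short-arc _≟_ t v spanning S uS |S| k≤p bound =
    weight≉0 C₀ (trans (sym (β-unique (Unique.take⁺ (suc t) uS))) β≈0)
    where
    C₀ = take (suc t) S
    C₁ = take t (drop (suc t) S)
    O = drop t (drop (suc t) S)
    S≡ : (C₀ ++ C₁) ++ O ≡ S
    S≡ = ≡.trans (++-assoc C₀ C₁ O) (≡.trans (≡.cong (C₀ ++_) (take++drop≡id t (drop (suc t) S))) (take++drop≡id (suc t) S))
    |C₀| : length C₀ ≡ suc t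
    |C₀| = ≡.trans (length-take (suc t) S) (ℕ.m≤n⇒m⊓n≡m (ℕ.≤-trans (ℕ.m≤m+n (suc t) t) (≡.subst (_ ≤_) (≡.sym |S|) bound)))
    |C₁| : length C₁ ≡ t
    |C₁| = ≡.trans (length-take t _) (ℕ.m≤n⇒m⊓n≡m (≡.subst (t ≤_) (≡.sym (length-drop (suc t) S))
             (ℕ.m+n≤o⇒m≤o∸n t (≡.subst₂ _≤_ (ℕ.+-comm (suc t) t) (≡.sym |S|) bound))))
    |E| : length (C₀ ++ C₁) ≡ suc t ℕ.+ t
    |E| = ≡.trans (length-++ C₀) (≡.cong₂ ℕ._+_ |C₀| |C₁|)
    count : suc t ℕ.+ suc t ℕ.+ length O ≡ q ℕ.+ 3
    count = ≡.trans (≡.cong (ℕ._+ length O) (ℕ.+-suc (suc t) t)) (≡.trans (≡.cong suc (≡.trans (≡.cong (ℕ._+ length O) (≡.sym |E|))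
      (≡.trans (≡.sym (length-++ (C₀ ++ C₁))) (≡.trans (≡.cong length S≡) |S|)))) (ℕ.+-comm 3 q))
    open Brackets _≟_ t v spanning (C₀ ++ C₁) O (≡.subst Uniqueₚ (≡.sym S≡) uS) |E| count
    β≈0 : β C₀ ≈ 0#
    β≈0 = β-vanishes C₀ C₁ (suc t) β β-↭ β-repeated β-sum |C₀| (≡.subst (_< suc t) (≡.sym |C₁|) (ℕ.n<1+n t))
      -- The factors of r! are at most r = k - 1 < p.
      (λ j j<r → ·1≉0 {h = h} p-prime q≡p^h (suc j) (ℕ.≤-trans (s≤s j<r) k≤p))

allPairs-lookup : ∀ {a r} {A : Set a} {R : Rel A r} → (∀ {x y} → R x y → R y x) → ∀ {xs} → AllPairs R xs →
                  ∀ {i j} → i ≢ j → R (lookup xs i) (lookup xs j)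
allPairs-lookup R-sym {x ∷ xs} (d ∷ ps) {zero}  {zero}  i≢j = contradiction ≡.refl i≢j
allPairs-lookup R-sym {x ∷ xs} (d ∷ ps) {zero}  {suc j} i≢j = All.lookup d (∈-lookup j)
allPairs-lookup R-sym {x ∷ xs} (d ∷ ps) {suc i} {zero}  i≢j = R-sym (All.lookup d (∈-lookup i))
allPairs-lookup R-sym {x ∷ xs} (d ∷ ps) {suc i} {suc j} i≢j = allPairs-lookup R-sym ps (i≢j ∘ ≡.cong suc)

-- Linear relations and the dual arc.

module Duality {c ℓ} (F : Field c ℓ) (q : ℕ) (size : HasSize (Field.setoid F) q) where

  open FiniteField F q size
  open Exterior F q size using (Vector; module Bracket)
  open Bracket using (Spanning)
  open import Relation.Binary.Reasoning.Setoid setoid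

  ∑-single : ∀ {i} {I : Set i} (f : I → Carrier) {a} L → Uniqueₚ L → a ∈ L →
             (∀ {b} → b ∈ L → b ≢ a → f b ≈ 0#) → ∑ f L ≈ f a
  ∑-single f (x ∷ L) (d ∷ _) (here ≡.refl) f≈0 =
    trans (+-congˡ (∑-zero L (λ b∈ → f≈0 (there b∈) (All.lookup d b∈ ∘ ≡.sym)))) (+-identityʳ _)
  ∑-single f (x ∷ L) (d ∷ u) (there a∈)    f≈0 =
    trans (+-cong (f≈0 (here ≡.refl) (All.lookup d a∈)) (∑-single f L u a∈ (f≈0 ∘ there))) (+-identityˡ _)

  ∑-neg : ∀ {i} {I : Set i} (f : I → Carrier) L → ∑ (λ i → - f i) L ≈ - ∑ f L
  ∑-neg f []      = sym -0#≈0#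
  ∑-neg f (i ∷ L) = trans (+-congˡ (∑-neg f L)) (-‿+-comm _ _)

  Independent : ∀ {n k} → (Fin n → Vector k) → List (Fin n) → Set (c ⊔ ℓ)
  Independent {n} v L = ∀ (a : Fin n → Carrier) → (∀ j → ∑ (λ i → a i * v i j) L ≈ 0#) → ∀ {i} → i ∈ L → a i ≈ 0#

  module _ {n k} (v : Fin n → Vector k)
    (spanning : ∀ L → Uniqueₚ L → length L ≡ k → Spanning Fin._≟_ v L)
    (independent : ∀ L → Uniqueₚ L → length L ≡ k → Independent v L)
    where

    -- In coding terms: the words of the code dual to the one whose generator matrix has the columns
    -- v i.
    Relation : (Fin n → Carrier) → Set ℓ
    Relation a = ∀ j → ∑ (λ i → a i * v i j) (allFin n) ≈ 0#

    module Circuits (L C : List (Fin n)) (split : allFin n ↭ L ++ C) (|C| : length C ≡ k) where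

      private
        uLC : Uniqueₚ (L ++ C)
        uLC = Unique-resp-↭ split (Unique.allFin⁺ n)

        uL : Uniqueₚ L
        uL = proj₁ (unique-++⁻ L uLC)

        uC : Uniqueₚ C
        uC = proj₂ (unique-++⁻ L uLC)

        expansion : Fin n → Fin n → Carrier
        expansion i = proj₁ (spanning C uC |C| (v i))

      -- For i in `L`, the fundamental circuit of i over the basis `C`: v i minus its expansion in
      -- `C`, read as a relation.
      circuit : Fin n → Fin n → Carrier
      circuit i s with s Fin.≟ i | Membership._∈?_ Fin._≟_ s C
      ... | yes _ | _     = 1#
      ... | no _  | yes _ = - expansion i s
      ... | no _  | no _  = 0#

      circuit-self : ∀ i → circuit i i ≈ 1#
      circuit-self i with i Fin.≟ i | Membership._∈?_ Fin._≟_ i C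
      ... | yes _  | _ = refl
      ... | no i≢i | _ = contradiction ≡.refl i≢i

      circuit-L : ∀ {i s} → s ∈ L → s ≢ i → circuit i s ≈ 0#
      circuit-L {i} {s} s∈ s≢i with s Fin.≟ i | Membership._∈?_ Fin._≟_ s C
      ... | yes s≡i | _     = contradiction s≡i s≢i
      ... | no _  | yes s∈C = contradiction ≡.refl (unique-++-disjoint uLC s∈ s∈C)
      ... | no _  | no _    = refl

      circuit-C : ∀ {i s} → i ∈ L → s ∈ C → circuit i s ≈ - expansion i s
      circuit-C {i} {s} i∈ s∈ with s Fin.≟ i | Membership._∈?_ Fin._≟_ s C
      ... | yes s≡i | _     = contradiction (≡.sym s≡i) (unique-++-disjoint uLC i∈ s∈)
      ... | no _  | yes _   = refl
      ... | no _  | no s∉C  = contradiction s∈ s∉C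

      circuit-relation : ∀ {i} → i ∈ L → Relation (circuit i)
      circuit-relation {i} i∈ j = begin
        ∑ f (allFin n)                                    ≈⟨ ∑-↭ f split ⟩
        ∑ f (L ++ C)                                      ≈⟨ ∑-++ f L C ⟩
        ∑ f L + ∑ f C                                     ≈⟨ +-cong
          (∑-single f L uL i∈ (λ s∈ s≢i → trans (*-congʳ (circuit-L s∈ s≢i)) (zeroˡ _)))
          (∑-cong C (λ s∈ → trans (*-congʳ (circuit-C i∈ s∈)) (sym (-‿distribˡ-* _ _)))) ⟩
        circuit i i * v i j + ∑ (λ s → - (expansion i s * v s j)) C
          ≈⟨ +-cong (trans (*-congʳ (circuit-self i)) (*-identityˡ _)) (∑-neg _ C) ⟩
        v i j - ∑ (λ s → expansion i s * v s j) C         ≈⟨ x≈y⇒x∙y⁻¹≈ε (proj₂ (spanning C uC |C| (v i)) j) ⟩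
        0#                                                ∎
        where
        f : Fin n → Carrier
        f s = circuit i s * v s j

      -- Such a relation is supported on `C`, whose vectors are independent.
      relation-vanishes : ∀ {h} → Relation h → (∀ {l} → l ∈ L → h l ≈ 0#) → ∀ s → h s ≈ 0#
      relation-vanishes {h} rel h≈0 s with ∈-++⁻ L (∈-resp-↭ split (∈-allFin s))
      ... | inj₁ s∈L = h≈0 s∈L
      ... | inj₂ s∈C = independent C uC |C| h (λ j → begin
        ∑ (λ i → h i * v i j) C                                  ≈⟨ +-identityˡ _ ⟨
        0# + ∑ (λ i → h i * v i j) C                             ≈⟨ +-congʳ (∑-zero L (λ l∈ → trans (*-congʳ (h≈0 l∈)) (zeroˡ _))) ⟨
        ∑ (λ i → h i * v i j) L + ∑ (λ i → h i * v i j) C        ≈⟨ ∑-++ _ L C ⟨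
        ∑ (λ i → h i * v i j) (L ++ C)                           ≈⟨ ∑-↭ _ split ⟨
        ∑ (λ i → h i * v i j) (allFin n)                         ≈⟨ rel j ⟩
        0#                                                       ∎) s∈C

      -- Both sides are relations and agree on `L`, where the circuits form an identity matrix.
      -- Hence the circuits of any split generate all relations.
      relation-expand : ∀ {g} → Relation g → ∀ s → g s ≈ ∑ (λ i → g i * circuit i s) L
      relation-expand {g} rel s = x∙y⁻¹≈ε⇒x≈y _ _ (relation-vanishes h-rel h-L s)
        where
        h : Fin n → Carrier
        h s = g s - ∑ (λ i → g i * circuit i s) L
        h-L : ∀ {l} → l ∈ L → h l ≈ 0#
        h-L {l} l∈ = x≈y⇒x∙y⁻¹≈ε (sym (trans
          (∑-single _ L uL l∈ (λ b∈ b≢l → trans (*-congˡ (circuit-L l∈ (b≢l ∘ ≡.sym))) (zeroʳ _)))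
          (trans (*-congˡ (circuit-self l)) (*-identityʳ _))))
        h-rel : Relation h
        h-rel j = begin
          ∑ (λ s → h s * v s j) (allFin n)
            ≈⟨ ∑-cong (allFin n) (λ {s} _ → trans (distribʳ _ _ _) (+-congˡ (trans (sym (-‿distribˡ-* _ _))
                 (-‿cong (trans (*-comm _ _) (trans (*-∑ (v s j) _ L) (∑-cong L (λ _ → trans (x*yz≈y*xz _ _ _) (*-congˡ (*-comm _ _)))))))))) ⟩
          ∑ (λ s → g s * v s j - ∑ (λ i → g i * (circuit i s * v s j)) L) (allFin n)
            ≈⟨ ∑-+ _ _ (allFin n) ⟩
          ∑ (λ s → g s * v s j) (allFin n) + ∑ (λ s → - ∑ (λ i → g i * (circuit i s * v s j)) L) (allFin n)
            ≈⟨ +-cong (rel j) (trans (∑-neg _ (allFin n)) (-‿cong (∑-swap _ (allFin n) L))) ⟩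
          0# - ∑ (λ i → ∑ (λ s → g i * (circuit i s * v s j)) (allFin n)) L
            ≈⟨ trans (+-identityˡ _) (-‿cong (∑-zero L (λ {i} i∈ →
                 trans (sym (*-∑ (g i) _ (allFin n))) (trans (*-congˡ (circuit-relation i∈ j)) (zeroʳ _))))) ⟩
          - 0#
            ≈⟨ -0#≈0# ⟩
          0# ∎

    module _ (R C : List (Fin n)) (split : allFin n ↭ R ++ C) (|C| : length C ≡ k) where

      open Circuits R C split |C| using (circuit; circuit-self; circuit-L; circuit-relation)

      -- Row j of the dual generator matrix is the relation among the v i that is
      -- supported on C and the j-th element of R.
      dual : Fin n → Vector (length R)
      dual i j = circuit (lookup R j) i

      -- The complement of `L` has k elements and carries circuits of its own. Expanding the rows of
      -- the dual matrix in these circuits and evaluating at `R` gives the identity matrix, so the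
      -- circuit values at `R` form a right inverse of the columns in `L`; `a` is that inverse
      -- applied to `w`.
      dual-spanning : ∀ L → Uniqueₚ L → length L ≡ length R → Spanning Fin._≟_ dual L
      dual-spanning L uL |L| w with C′ , split′ ← unique-⊆⇒↭++ uL (λ _ → ∈-allFin _) = a , λ j → sym (begin
        ∑ (λ i → a i * dual i j) L
          ≈⟨ ∑-cong L (λ _ → trans (*-comm _ _) (trans (*-∑ _ _ (allFin m)) (∑-cong (allFin m) (λ _ → x*yz≈y*xz _ _ _)))) ⟩
        ∑ (λ i → ∑ (λ l → w l * (dual i j * L.circuit i (lookup R l))) (allFin m)) L
          ≈⟨ ∑-swap _ L (allFin m) ⟩
        ∑ (λ l → ∑ (λ i → w l * (dual i j * L.circuit i (lookup R l))) L) (allFin m)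
          ≈⟨ ∑-cong (allFin m) (λ {l} _ → trans (sym (*-∑ (w l) _ L))
               (*-congˡ (sym (L.relation-expand (circuit-relation (∈-lookup j)) (lookup R l))))) ⟩
        ∑ (λ l → w l * circuit (lookup R j) (lookup R l)) (allFin m)
          ≈⟨ ∑-single _ (allFin m) (Unique.allFin⁺ m) (∈-allFin j) (λ {l} _ l≢j →
               trans (*-congˡ (circuit-L (∈-lookup l) (allPairs-lookup (_∘ ≡.sym) uR l≢j))) (zeroʳ _)) ⟩
        w j * circuit (lookup R j) (lookup R j)
          ≈⟨ trans (*-congˡ (circuit-self (lookup R j))) (*-identityʳ _) ⟩
        w j ∎)
        where
        m = length R
        uR : Uniqueₚ R
        uR = proj₁ (unique-++⁻ R (Unique-resp-↭ split (Unique.allFin⁺ n)))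
        |C′| : length C′ ≡ k
        |C′| = ℕ.+-cancelˡ-≡ m _ _ (≡.trans (≡.cong (ℕ._+ length C′) (≡.sym |L|)) (≡.trans (≡.sym (length-++ L))
          (≡.trans (≡.sym (↭-length split′)) (≡.trans (↭-length split) (≡.trans (length-++ R) (≡.cong (m ℕ.+_) |C|))))))
        module L = Circuits L C′ split′ |C′|
        a : Fin n → Carrier
        a i = ∑ (λ l → w l * L.circuit i (lookup R l)) (allFin m)

-- Choosing between the arc and its dual.

module ArcSize {c ℓ} (F : Field c ℓ) (q : ℕ) (size : HasSize (Field.setoid F) q) (1<q : 1 < q)
  {p h} (p-prime : Prime p) (q≡p^h : q ≡ p ℕ.^ h) (p≤q : p ≤ q) where

  open FiniteField F q size
  open Exterior F q size using (Vector; module Bracket)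
  open Bracket using (Spanning)
  open Duality F q size
  open ArcBound F q size 1<q {h = h} p-prime q≡p^h using (short-arc)
  open import Relation.Binary.Reasoning.Setoid setoid

  -- If 2t + 1 > q + 2 and q = 2 + t + t′, then t′ ≤ t. So the dual arc, in dimension 2 + t′,
  -- inherits the bound by p, and 2t′ + 1 ≤ q + 2 holds for it.
  no-arc : ∀ t (v : Fin (2 ℕ.+ q) → Vector (2 ℕ.+ t)) →
    (∀ L → Uniqueₚ L → length L ≡ 2 ℕ.+ t → Spanning Fin._≟_ v L) →
    (∀ L → Uniqueₚ L → length L ≡ 2 ℕ.+ t → Independent v L) →
    2 ℕ.+ t ≤ p → ⊥
  no-arc t v spanning independent k≤p with suc t ℕ.+ t ℕ.≤? 2 ℕ.+ q
  ... | yes short = short-arc Fin._≟_ t v spanning (allFin _) (Unique.allFin⁺ _) (length-tabulate id) k≤p short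
  -- From k ≤ p ≤ q the difference q - k is a natural number t′, so the dual dimension q + 2 - k is
  -- at least 2.
  ... | no ¬short with t′ , ≡.refl ← ℕ.m≤n⇒∃[o]m+o≡n (ℕ.≤-trans k≤p p≤q) =
    dual-case (length R) (dual v spanning independent R C split |C|) |R| (dual-spanning v spanning independent R C split |C|)
    where
    S R C : List (Fin (4 ℕ.+ t ℕ.+ t′))
    S = allFin _
    C = take (2 ℕ.+ t) S
    R = drop (2 ℕ.+ t) S
    |S| : length S ≡ (2 ℕ.+ t) ℕ.+ (2 ℕ.+ t′)
    |S| = ≡.trans (length-tabulate id) (≡.cong (2 ℕ.+_) (≡.sym (≡.trans (ℕ.+-suc t _) (≡.cong suc (ℕ.+-suc t t′)))))
    split : S ↭ R ++ C
    split = ↭-trans (↭-reflexive (≡.sym (take++drop≡id (2 ℕ.+ t) S))) (++-comm C R)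
    |C| : length C ≡ 2 ℕ.+ t
    |C| = ≡.trans (length-take (2 ℕ.+ t) S) (ℕ.m≤n⇒m⊓n≡m (≡.subst (2 ℕ.+ t ≤_) (≡.sym |S|) (ℕ.m≤m+n _ _)))
    |R| : length R ≡ 2 ℕ.+ t′
    |R| = ≡.trans (length-drop (2 ℕ.+ t) S) (≡.trans (≡.cong (ℕ._∸ (2 ℕ.+ t)) |S|) (ℕ.m+n∸m≡n (2 ℕ.+ t) _))
    t′≤t : t′ ≤ t
    t′≤t = ℕ.+-cancelˡ-≤ t _ _ (ℕ.≤-trans (ℕ.m≤n+m (t ℕ.+ t′) 4) (ℕ.s≤s⁻¹ (ℕ.≰⇒> ¬short)))
    -- Abstracting the dimension lets `length R` be replaced by 2 + t′, the form that `short-arc`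
    -- expects.
    dual-case : ∀ k (d : Fin (4 ℕ.+ t ℕ.+ t′) → Vector k) → k ≡ 2 ℕ.+ t′ →
      (∀ L → Uniqueₚ L → length L ≡ k → Spanning Fin._≟_ d L) → ⊥
    dual-case _ d ≡.refl spans = short-arc Fin._≟_ t′ d spans (allFin _) (Unique.allFin⁺ _) (length-tabulate id)
      (ℕ.≤-trans (s≤s (s≤s t′≤t)) k≤p) (s≤s (ℕ.≤-trans (ℕ.+-monoˡ-≤ t′ t′≤t) (ℕ.m≤n+m _ 3)))

-- From coefficients attached to list positions to coefficients attached to indices.

module ListBasis {c ℓ} (F : Field c ℓ) (q : ℕ) (size : HasSize (Field.setoid F) q) (k : ℕ) where

  open FiniteField F q size
  open CoordinateSpace F k using (V)
  module V = CoordinateSpace F k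
  open Exterior F q size using (module Bracket)
  open Duality F q size using (Independent)

  module _ {n} (v : Fin n → V) where

    restrict : (Fin n → Carrier) → ∀ L → Fin (length (map v L)) → Carrier
    restrict a (i ∷ L) zero    = a i
    restrict a (i ∷ L) (suc m) = restrict a L m

    restrict-combination : ∀ a L j → V.linearCombination (restrict a L) (lookup (map v L)) j ≈ ∑ (λ i → a i * v i j) L
    restrict-combination a []      j = refl
    restrict-combination a (i ∷ L) j = +-congˡ (restrict-combination a L j)

    restrict-zero : ∀ a L → (∀ m → restrict a L m ≈ 0#) → ∀ {i} → i ∈ L → a i ≈ 0#
    restrict-zero a (i ∷ L) a≈0 (here ≡.refl) = a≈0 zero
    restrict-zero a (i ∷ L) a≈0 (there i∈)    = restrict-zero a L (a≈0 ∘ suc) i∈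

    independent : ∀ L → V.LinearlyIndependent (lookup (map v L)) → Independent v L
    independent L li a e = restrict-zero a L (li (restrict a L) (λ j → trans (restrict-combination a L j) (e j)))

    extend : ∀ L → (Fin (length (map v L)) → Carrier) → Fin n → Carrier
    extend []      a s = 0#
    extend (i ∷ L) a s with s Fin.≟ i
    ... | yes _ = a zero
    ... | no _  = extend L (a ∘ suc) s

    extend-here : ∀ i L a → extend (i ∷ L) a i ≈ a zero
    extend-here i L a with i Fin.≟ i
    ... | yes _  = refl
    ... | no i≢i = contradiction ≡.refl i≢i

    extend-there : ∀ {i} L a {s} → s ≢ i → extend (i ∷ L) a s ≈ extend L (a ∘ suc) s
    extend-there {i} L a {s} s≢i with s Fin.≟ i
    ... | yes s≡i = contradiction s≡i s≢i
    ... | no _    = refl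

    extend-combination : ∀ L a → Uniqueₚ L → ∀ j → V.linearCombination a (lookup (map v L)) j ≈ ∑ (λ i → extend L a i * v i j) L
    extend-combination []      a _       j = refl
    extend-combination (i ∷ L) a (d ∷ u) j = +-cong (*-congʳ (sym (extend-here i L a)))
      (trans (extend-combination L (a ∘ suc) u j)
        (∑-cong L (λ s∈ → *-congʳ (sym (extend-there L a (All.lookup d s∈ ∘ ≡.sym))))))

    spanning : ∀ L → Uniqueₚ L → V.Spanning (lookup (map v L)) → Bracket.Spanning Fin._≟_ v L
    spanning L u spans w = let a , e = spans w in
      extend L a , λ j → trans (sym (e j)) (extend-combination L a u j)

open import Data.Nat.Base using (_+_; _^_)

theorem3p2 : ∀ {c ℓ : Level} (p h q k : ℕ) → Prime p → 1 ≤ h → q ≡ p ^ h → 1 ≤ k →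
  (F : Field c ℓ) → HasSize (Field.setoid F) q →
  let open CoordinateSpace F k in
  (S : List V) → Unique S →
  (∀ (T : List V) → Unique T → T ⊆ S → length T ≡ k → IsBasis (lookup T)) →
  k ≤ p → length S ≤ q + 1
-- For k = 1 the space has only q vectors. This case stands apart because r - 1 would be negative.
theorem3p2 p h q (suc zero) _ _ _ _ F size S uS _ _ =
  ℕ.≤-trans (≡.subst₂ _≤_ (length-map _ S) length-elements (unique-⊆⇒length≤ distinct (λ _ → ∈-allFin _))) (ℕ.m≤m+n q 1)
  where
  open FiniteField F q size
  open CoordinateSpace F 1 using (V)
  distinct : Uniqueₚ (map (λ (x : V) → to (x zero)) S)
  distinct = AllPairs.map⁺ (AllPairs.map (λ x≉y e → x≉y (λ { zero → to-injective e })) uS)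
theorem3p2 p h q (suc (suc t)) p-prime 1≤h q≡p^h _ F size S uS basis k≤p with length S ℕ.≤? q ℕ.+ 1
... | yes small = small
... | no ¬small = ⊥-elim (no-arc t v (λ L u e → spanning v L u (proj₂ (is-basis L u e)))
                    (λ L u e → independent v L (proj₁ (is-basis L u e))) k≤p)
  where
  instance
    p≢0 = prime⇒nonZero p-prime
  p≤q : p ≤ q
  p≤q = ≡.subst₂ _≤_ (ℕ.^-identityʳ p) (≡.sym q≡p^h) (ℕ.^-monoʳ-≤ p 1≤h)
  1<q : 1 < q
  1<q = ℕ.≤-trans (ℕ.nonTrivial⇒n>1 p {{prime⇒nonTrivial p-prime}}) p≤q
  open CoordinateSpace F (2 ℕ.+ t) using (V; _⊆_; IsBasis) renaming (Unique to Uniqueᵥ)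
  open ArcSize F q size 1<q {h = h} p-prime q≡p^h p≤q
  open ListBasis F q size (2 ℕ.+ t)
  open FiniteField F q size using (sym; trans)
  2+q≤|S| : 2 ℕ.+ q ≤ length S
  2+q≤|S| = ≡.subst (_≤ length S) (≡.cong suc (ℕ.+-comm q 1)) (ℕ.≰⇒> ¬small)
  index : Fin (2 ℕ.+ q) → Fin (length S)
  index i = inject≤ i 2+q≤|S|
  -- A set larger than q + 1 is cut down to its first q + 2 vectors, which again form an arc.
  v : Fin (2 ℕ.+ q) → V
  v = lookup S ∘ index
  v-unique : ∀ {L} → Uniqueₚ L → Uniqueᵥ (map v L)
  v-unique u = AllPairs.map⁺ (AllPairs.map (λ i≢j →
    allPairs-lookup (λ x≉y y≈x → x≉y (λ l → sym (y≈x l))) uS (i≢j ∘ Fin.inject≤-injective _ _ _ _)) u)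
  v-⊆ : ∀ L → map v L ⊆ S
  v-⊆ (i ∷ L) (here e)   = Any.map (λ { ≡.refl → e }) (∈-lookup {xs = S} (index i))
  v-⊆ (i ∷ L) (there x∈) = v-⊆ L x∈
  is-basis : ∀ L → Uniqueₚ L → length L ≡ 2 ℕ.+ t → IsBasis (lookup (map v L))
  is-basis L u e = basis (map v L) (v-unique u) (v-⊆ L) (≡.trans (length-map v L) e)
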